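{- No online algorithm for online stochastic bipartite matching with edge arrivals is better than $\frac23$-competitive: for every $\gamma>\frac23$ and every (possibly randomized) online algorithm there exist a finite stochastic bipartite graph and a fixed edge arrival order for which the expected size of the matching produced by the algorithm is less than $\gamma\cdot\mathrm{OPT}$.
   Context: Stochastic bipartite graph: a finite bipartite multigraph $G=(L,R,E)$ in which each edge $e$ is realized independently with probability $p_e\in[0,1]$; $G$ and $(p_e)_{e\in E}$ are known to the algorithm in advance. All edges of $E$ arrive one by one in a fixed order (oblivious adversary). When $e$ arrives, the algorithm observes whether $e$ is realized; if it is, the algorithm immediately and irrevocably decides whether to add $e$ to its matching (the chosen edges must always form a matching); if not, it does nothing. Decisions may depend only on what has been observed so far (and internal randomness). $\mathrm{OPT}$ is the expected size of a maximum matching of the realized graph. An algorithm is $\gamma$-competitive if its expected matching size is at least $\gamma\cdot \mathrm{OPT}$ for every instance and every arrival order. -}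

module Defs where

open import Level using (Level; _⊔_) renaming (suc to lsuc)
open import Algebra.Apartness.Bundles using (HeytingField; HeytingCommutativeRing)
open import Algebra.Bundles using (CommutativeRing)
import Algebra.Apartness.Properties.HeytingCommutativeRing as HCRProperties
import Algebra.Properties.Group as GroupProperties
import Algebra.Properties.Ring as RingProperties
import Algebra.Properties.Monoid.Mult as Mult
import Algebra.Properties.CommutativeMonoid.Sum as Sum
open import Data.Bool.Base using (Bool; if_then_else_; _∧_)
open import Data.Fin.Base using (Fin)
import Data.Fin.Properties as Fin
open import Data.Fin.Subset using (Subset; inside; outside; _∈_; _⊆_; _∪_; ⁅_⁆; ∣_∣; ⊥)
open import Data.Fin.Subset.Properties using (_∈?_; _⊆?_)
open import Data.List.Base as List using (List; []; _∷_; _++_; allFin; filter; foldr)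
open import Data.List.Extrema.Nat using (max)
open import Data.List.Relation.Binary.Permutation.Propositional using (_↭_)
open import Data.Nat.Base using (ℕ; zero; suc)
open import Data.Product.Base using (Σ; ∃; _×_; _,_; proj₁)
open import Data.Sum.Base using (_⊎_; inj₁; inj₂)
open import Data.Vec.Base as Vec using (lookup)
open import Relation.Binary.Core using (Rel)
open import Relation.Binary.Definitions using (Cotransitive)
open import Relation.Binary.PropositionalEquality using (_≡_)
open import Relation.Binary.Structures using (IsStrictPartialOrder)
open import Relation.Nullary using (Dec; ¬_; does)
open import Relation.Nullary.Decidable using (_×-dec_; _⊎-dec_; _→-dec_)

-- The library has no real numbers.  Probabilities and γ are taken from an
-- arbitrary Archimedean ordered field.  The axioms are those satisfied
-- constructively by the reals (cotransitivity in place of trichotomy), so the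
-- models include ℚ, the constructive reals, and the classical field ℝ.
-- 0 < 1 and compatibility with inverses are consequences.
record ArchimedeanOrderedField (c ℓ₁ ℓ₂ ℓ₃ : Level) : Set (lsuc (c ⊔ ℓ₁ ⊔ ℓ₂ ⊔ ℓ₃)) where
  infix 4 _<_ _≤_
  field
    heytingField : HeytingField c ℓ₁ ℓ₂

  open HeytingField heytingField public

  open HeytingCommutativeRing heytingCommutativeRing public using (commutativeRing)
  open CommutativeRing commutativeRing public
    using (ring; +-group; +-monoid; +-commutativeMonoid; *-commutativeMonoid)

  open Mult +-monoid using () renaming (_×_ to _·_)

  field
    _<_                    : Rel Carrier ℓ₃
    <-isStrictPartialOrder : IsStrictPartialOrder _≈_ _<_
    <-cotrans              : Cotransitive _<_
    #⇒<⊎>                  : ∀ {x y} → x # y → (x < y) ⊎ (y < x)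
    <⇒#                    : ∀ {x y} → x < y → x # y
    +-monoˡ-<              : ∀ {x y} z → x < y → x + z < y + z
    *-pos                  : ∀ {x y} → 0# < x → 0# < y → 0# < x * y
    archimedean            : ∀ x → ∃ λ n → x < n · 1#

  fromℕ : ℕ → Carrier
  fromℕ n = n · 1#

  _≤_ : Rel Carrier ℓ₃
  x ≤ y = ¬ (y < x)

  private
    open module Order = IsStrictPartialOrder <-isStrictPartialOrder
      using (<-respˡ-≈; <-respʳ-≈) renaming (trans to <-trans)

  0<1 : 0# < 1#
  0<1 with #⇒<⊎> (HCRProperties.1#0 heytingCommutativeRing)
  ... | inj₂ 0<1′ = 0<1′
  ... | inj₁ 1<0  = <-respʳ-≈ -1*-1≈1 (*-pos 0<-1 0<-1)
    where
    open RingProperties ring using (-1*x≈-x)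
    open GroupProperties +-group using (⁻¹-involutive)
    0<-1 : 0# < - 1#
    0<-1 = <-respʳ-≈ (+-identityˡ (- 1#)) (<-respˡ-≈ (-‿inverseʳ 1#) (+-monoˡ-< (- 1#) 1<0))
    -1*-1≈1 : (- 1#) * (- 1#) ≈ 1#
    -1*-1≈1 = trans (-1*x≈-x (- 1#)) (⁻¹-involutive 1#)

  0<fromℕ-suc : ∀ n → 0# < fromℕ (suc n)
  0<fromℕ-suc zero    = <-respʳ-≈ (sym (+-identityʳ 1#)) 0<1
  0<fromℕ-suc (suc n) =
    <-trans (0<fromℕ-suc n)
      (<-respˡ-≈ (+-identityˡ (fromℕ (suc n))) (+-monoˡ-< (fromℕ (suc n)) 0<1))

  -- #⇒invertible inverts x - 0# rather than x.
  recip : ∀ x → 0# < x → Carrier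
  recip x 0<x = proj₁ (#⇒invertible {x} {0#} (#-sym (<⇒# 0<x)))

  2/3 : Carrier
  2/3 = fromℕ 2 * recip (fromℕ 3) (0<fromℕ-suc 2)

-- Edges are labels, so parallel edges are allowed.
record BipartiteMultigraph : Set where
  field
    #L #R #E : ℕ
    left  : Fin #E → Fin #L
    right : Fin #E → Fin #R

  Edge : Set
  Edge = Fin #E

  EdgeSet : Set
  EdgeSet = Subset #E

  ShareVertex : Edge → Edge → Set
  ShareVertex e f = (left e ≡ left f) ⊎ (right e ≡ right f)

  IsMatching : EdgeSet → Set
  IsMatching M = ∀ e f → e ∈ M → f ∈ M → ShareVertex e f → e ≡ f

  isMatching? : ∀ M → Dec (IsMatching M)
  isMatching? M = Fin.all? λ e → Fin.all? λ f →
    (e ∈? M) →-dec ((f ∈? M) →-dec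
      (((left e Fin.≟ left f) ⊎-dec (right e Fin.≟ right f)) →-dec (e Fin.≟ f)))

subsets : ∀ n → List (Subset n)
subsets zero    = Vec.[] ∷ []
subsets (suc n) =
  List.map (inside Vec.∷_) (subsets n) ++ List.map (outside Vec.∷_) (subsets n)

module _ (G : BipartiteMultigraph) where
  open BipartiteMultigraph G

  maxMatchingSize : EdgeSet → ℕ
  maxMatchingSize S =
    max 0 (List.map ∣_∣ (filter (λ M → (M ⊆? S) ×-dec isMatching? M) (subsets #E)))

  -- The edges that have arrived, most recent first, each with the flag
  -- recording whether it was realized.
  History : Set
  History = List (Edge × Bool)

  -- The answer for a history and an arriving realized edge says whether to add
  -- that edge.  The algorithm's own earlier choices are determined by the
  -- history, so they need not be an extra argument.
  DeterministicPolicy : Set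
  DeterministicPolicy = History → Edge → Bool

  -- In run d S h M es, S is the set of realized edges, h the history, M the
  -- current matching and es the edges yet to arrive.  A positive answer that
  -- would break the matching property has no effect.
  run : DeterministicPolicy → EdgeSet → History → EdgeSet → List Edge → EdgeSet
  run d S h M []       = M
  run d S h M (e ∷ es) = run d S ((e , realized) ∷ h) M′ es
    where
    realized : Bool
    realized = lookup S e
    M′ : EdgeSet
    M′ = if realized ∧ d h e ∧ does (isMatching? (M ∪ ⁅ e ⁆)) then M ∪ ⁅ e ⁆ else M

  ArrivalOrder : Set
  ArrivalOrder = Σ (List Edge) λ es → es ↭ allFin #E

  outcome : DeterministicPolicy → ArrivalOrder → EdgeSet → EdgeSet
  outcome d (es , _) S = run d S [] ⊥ es

module Model {c ℓ₁ ℓ₂ ℓ₃ : Level} (F : ArchimedeanOrderedField c ℓ₁ ℓ₂ ℓ₃) where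
  open ArchimedeanOrderedField F
  open Sum +-commutativeMonoid using (sum)
  open Sum *-commutativeMonoid using () renaming (sum to product)

  record StochasticGraph : Set (c ⊔ ℓ₃) where
    field
      graph : BipartiteMultigraph
    open BipartiteMultigraph graph public
    field
      p   : Edge → Carrier
      0≤p : ∀ e → 0# ≤ p e
      p≤1 : ∀ e → p e ≤ 1#

  module _ (I : StochasticGraph) where
    open StochasticGraph I

    prob : EdgeSet → Carrier
    prob S = product (λ e → if lookup S e then p e else (1# - p e))

    𝔼 : (EdgeSet → Carrier) → Carrier
    𝔼 X = foldr _+_ 0# (List.map (λ S → prob S * X S) (subsets #E))

    OPT : Carrier
    OPT = 𝔼 (λ S → fromℕ (maxMatchingSize graph S))

    -- A seed is drawn before the first arrival, independently of the
    -- realization.  Finitely many seeds suffice: up to behaviour on the finitely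
    -- many histories that can occur, I has finitely many deterministic policies.
    record RandomizedPolicy : Set (c ⊔ ℓ₁ ⊔ ℓ₃) where
      field
        #seeds   : ℕ
        weight   : Fin #seeds → Carrier
        0≤weight : ∀ ω → 0# ≤ weight ω
        Σweight  : sum weight ≈ 1#
        policy   : Fin #seeds → DeterministicPolicy graph

    expectedSize : RandomizedPolicy → ArrivalOrder graph → Carrier
    expectedSize A σ =
      sum (λ ω → weight ω * 𝔼 (λ S → fromℕ ∣ outcome graph (policy ω) σ S ∣))
      where open RandomizedPolicy A

  -- The stochastic graph, but not the arrival order, is known in advance.
  OnlineAlgorithm : Set (c ⊔ ℓ₁ ⊔ ℓ₃)
  OnlineAlgorithm = (I : StochasticGraph) → RandomizedPolicy I

{-# OPTIONS --safe #-}

-- All n² edges of K_{n,n} are realized and arrive first; then a pendant edge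
-- arrives at each of the 2n vertices, each realized with probability 1/2.
-- Matching a core edge gains 1 but loses the two pendant edges at its ends, worth
-- 1/2 each, so every policy has expected size at most n.  In hindsight, if a and b
-- pendant edges are realized on the two sides, taking them all and matching the
-- remaining core vertices with each other gives n + min(a, b), whose expectation
-- is 3n/2 − O(√n).
--
-- A realization is thus a subset T of the 2n pendant edges, uniformly distributed,
-- and both expectations are sums over T of natural numbers, divided by 4ⁿ.
module Submission where

open import Defs
open import Algebra.Bundles using (CommutativeRing)
import Algebra.Apartness.Properties.HeytingCommutativeRing as HCR
import Algebra.Properties.CommutativeMonoid.Sum as Sum
import Algebra.Properties.CommutativeSemigroup as CommutativeSemigroup
import Algebra.Properties.Group as Group
import Algebra.Properties.Semiring.Exp as Exp
import Algebra.Properties.Semiring.Mult as Mult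
import Algebra.Properties.Semiring.Sum as SemiringSum
open import Data.Bool.Base using (if_then_else_)
open import Data.Empty using (⊥-elim)
open import Data.Fin.Base using (Fin; zero; suc)
open import Data.Fin.Subset using (Subset; inside; outside; ∁; ∣_∣)
open import Data.Fin.Subset.Properties
open import Data.List.Base as List using (List; []; _∷_)
import Data.List.Properties as List
open import Data.Nat.Base as ℕ using (ℕ; zero; suc)
import Data.Nat.Properties as ℕ
open import Data.Nat.Tactic.RingSolver using (solve-∀)
open import Data.Product.Base using (Σ; ∃; ∃₂; _×_; _,_; proj₁; proj₂)
open import Data.Sum.Base using (inj₁; inj₂)
open import Data.Vec.Base using ([]; _∷_; _++_; lookup; replicate)
open import Function.Base using (_∘_)
open import Relation.Binary.PropositionalEquality as ≡ using (_≡_)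
import Relation.Binary.Reasoning.Setoid as ≈-Reasoning
open import Relation.Binary.Structures using (IsStrictPartialOrder)

-- The bound for a policy is proved without conditional expectations. The core decisions precede
-- every observation of a pendant edge, so the runs on `T` and on its complement hold the same core
-- edges; a counting argument then bounds their two sizes together by 2n, for each `T` separately.
-- Averaging over `T`, and afterwards over the seeds, gives n. For the optimum, E|a - b| has to be
-- bounded above. Instead of a square root or central binomial coefficients, 2t|a - b| ≤ (a - b)² +
-- t² with a free natural number t reduces this to a second moment, which is exactly n/2. For n =
-- 2t² the optimum is at least 3n/2 - t/2 and also at least t², so the loss is a fraction of order
-- 1/t. Choosing t with (3γ - 2)t > 1 absorbs it. All combinatorics takes place in ℕ; the field,
-- whose `≤` is only the negation of `<`, enters at the end.

module SubsetSums where
  open CommutativeSemigroup using (interchange)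
  open import Data.Nat.Base
  open import Data.Nat.Properties
  open ≡

  -- Moments of the size of a uniform subset, and the mean minimum of two such sizes.

  total : ∀ m → (Subset m → ℕ) → ℕ
  total zero    X = X []
  total (suc m) X = total m (X ∘ (inside ∷_)) + total m (X ∘ (outside ∷_))

  total-mono : ∀ m {X Y : Subset m → ℕ} → (∀ T → X T ≤ Y T) → total m X ≤ total m Y
  total-mono zero    X≤Y = X≤Y []
  total-mono (suc m) X≤Y =
    +-mono-≤ (total-mono m (X≤Y ∘ (inside ∷_))) (total-mono m (X≤Y ∘ (outside ∷_)))

  total-cong : ∀ m {X Y : Subset m → ℕ} → (∀ T → X T ≡ Y T) → total m X ≡ total m Y
  total-cong zero    X≡Y = X≡Y []
  total-cong (suc m) X≡Y =
    cong₂ _+_ (total-cong m (X≡Y ∘ (inside ∷_))) (total-cong m (X≡Y ∘ (outside ∷_)))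

  total-+ : ∀ m (X Y : Subset m → ℕ) → total m (λ T → X T + Y T) ≡ total m X + total m Y
  total-+ zero    X Y = refl
  total-+ (suc m) X Y
    rewrite total-+ m (X ∘ (inside ∷_)) (Y ∘ (inside ∷_))
          | total-+ m (X ∘ (outside ∷_)) (Y ∘ (outside ∷_)) =
    interchange +-commutativeSemigroup (total m (X ∘ (inside ∷_))) _ _ _

  total-* : ∀ m c (X : Subset m → ℕ) → total m (λ T → c * X T) ≡ c * total m X
  total-* zero    c X = refl
  total-* (suc m) c X
    rewrite total-* m c (X ∘ (inside ∷_)) | total-* m c (X ∘ (outside ∷_)) =
    sym (*-distribˡ-+ c _ _)

  total-const : ∀ m c → total m (λ _ → c) ≡ 2 ^ m * c
  total-const zero    c = sym (+-identityʳ c)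
  total-const (suc m) c rewrite total-const m c = lemma (2 ^ m) c
    where
    lemma : ∀ N c → N * c + N * c ≡ (N + (N + 0)) * c
    lemma = solve-∀

  total-∁ : ∀ m (X : Subset m → ℕ) → total m (X ∘ ∁) ≡ total m X
  total-∁ zero    X = refl
  total-∁ (suc m) X
    rewrite total-∁ m (X ∘ (inside ∷_)) | total-∁ m (X ∘ (outside ∷_)) =
    +-comm (total m (X ∘ (outside ∷_))) _

  total-++ : ∀ k l (X : Subset (k + l) → ℕ) →
    total (k + l) X ≡ total k (λ A → total l (λ B → X (A ++ B)))
  total-++ zero    l X = refl
  total-++ (suc k) l X = cong₂ _+_ (total-++ k l _) (total-++ k l _)

  total-∣∣ : ∀ m → 2 * total m ∣_∣ ≡ m * 2 ^ m
  total-∣∣ zero    = refl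
  total-∣∣ (suc m) = begin
    2 * (total m (λ T → suc ∣ T ∣) + total m ∣_∣)
      ≡⟨ cong (λ s → 2 * (s + total m ∣_∣))
           (trans (total-+ m (λ _ → 1) ∣_∣) (cong (_+ total m ∣_∣) (total-const m 1))) ⟩
    2 * (2 ^ m * 1 + total m ∣_∣ + total m ∣_∣)
      ≡⟨ lemma₁ (2 ^ m) (total m ∣_∣) ⟩
    2 * 2 ^ m + 2 * (2 * total m ∣_∣)
      ≡⟨ cong (λ s → 2 * 2 ^ m + 2 * s) (total-∣∣ m) ⟩
    2 * 2 ^ m + 2 * (m * 2 ^ m)
      ≡⟨ lemma₂ m (2 ^ m) ⟩
    suc m * (2 ^ suc m) ∎
    where
    open ≡-Reasoning
    lemma₁ : ∀ N s → 2 * (N * 1 + s + s) ≡ 2 * N + 2 * (2 * s)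
    lemma₁ = solve-∀
    lemma₂ : ∀ m N → 2 * N + 2 * (m * N) ≡ (1 + m) * (N + (N + 0))
    lemma₂ = solve-∀

  -- A fair binomial variable has second moment (m² + m)/4; the factor 4 keeps the identity in ℕ.
  total-∣∣² : ∀ m → 4 * total m (λ T → ∣ T ∣ * ∣ T ∣) ≡ (m * m + m) * 2 ^ m
  total-∣∣² zero    = refl
  total-∣∣² (suc m) = begin
    4 * (total m (λ T → suc ∣ T ∣ * suc ∣ T ∣) + q)
      ≡⟨ cong (λ s → 4 * (s + q)) expand ⟩
    4 * (2 ^ m * 1 + 2 * s + q + q)
      ≡⟨ lemma₁ (2 ^ m) s q ⟩
    4 * 2 ^ m + 4 * (2 * s) + 2 * (4 * q)
      ≡⟨ cong₂ (λ s q → 4 * 2 ^ m + 4 * s + 2 * q) (total-∣∣ m) (total-∣∣² m) ⟩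
    4 * 2 ^ m + 4 * (m * 2 ^ m) + 2 * ((m * m + m) * 2 ^ m)
      ≡⟨ lemma₂ m (2 ^ m) ⟩
    (suc m * suc m + suc m) * 2 ^ suc m ∎
    where
    open ≡-Reasoning
    s q : ℕ
    s = total m ∣_∣
    q = total m (λ T → ∣ T ∣ * ∣ T ∣)
    square-suc : ∀ c → (1 + c) * (1 + c) ≡ 1 + 2 * c + c * c
    square-suc = solve-∀
    expand : total m (λ T → suc ∣ T ∣ * suc ∣ T ∣) ≡ 2 ^ m * 1 + 2 * s + q
    expand = trans (total-cong m (λ T → square-suc ∣ T ∣))
      (trans (total-+ m (λ T → 1 + 2 * ∣ T ∣) _)
        (cong (_+ q) (trans (total-+ m (λ _ → 1) _) (cong₂ _+_ (total-const m 1) (total-* m 2 ∣_∣)))))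
    lemma₁ : ∀ N s q → 4 * (N * 1 + 2 * s + q + q) ≡ 4 * N + 4 * (2 * s) + 2 * (4 * q)
    lemma₁ = solve-∀
    lemma₂ : ∀ m N → 4 * N + 4 * (m * N) + 2 * ((m * m + m) * N)
      ≡ ((1 + m) * (1 + m) + (1 + m)) * (N + (N + 0))
    lemma₂ = solve-∀

  -- The binomial formula for (x - y)², with the cross term moved to the left so that nothing is
  -- subtracted.
  ∣-∣²+2*≡ : ∀ x y → ∣ x - y ∣ * ∣ x - y ∣ + 2 * (x * y) ≡ x * x + y * y
  ∣-∣²+2*≡ x y with ≤-total x y
  ... | inj₁ x≤y rewrite m≤n⇒∣m-n∣≡n∸m x≤y =
    subst (λ z → (y ∸ x) * (y ∸ x) + 2 * (x * z) ≡ x * x + z * z) (m+[n∸m]≡n x≤y) (lemma x (y ∸ x))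
    where
    lemma : ∀ x d → d * d + 2 * (x * (x + d)) ≡ x * x + (x + d) * (x + d)
    lemma = solve-∀
  ... | inj₂ y≤x rewrite m≤n⇒∣n-m∣≡n∸m y≤x =
    subst (λ z → (x ∸ y) * (x ∸ y) + 2 * (z * y) ≡ z * z + y * y) (m+[n∸m]≡n y≤x) (lemma y (x ∸ y))
    where
    lemma : ∀ y d → d * d + 2 * ((y + d) * y) ≡ (y + d) * (y + d) + y * y
    lemma = solve-∀

  2⊓+∣-∣≡ : ∀ x y → 2 * (x ⊓ y) + ∣ x - y ∣ ≡ x + y
  2⊓+∣-∣≡ x y with ≤-total x y
  ... | inj₁ x≤y rewrite m≤n⇒∣m-n∣≡n∸m x≤y | m≤n⇒m⊓n≡m x≤y =
    trans (lemma x (y ∸ x)) (cong (x +_) (m+[n∸m]≡n x≤y))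
    where
    lemma : ∀ x d → 2 * x + d ≡ x + (x + d)
    lemma = solve-∀
  ... | inj₂ y≤x rewrite m≤n⇒∣n-m∣≡n∸m y≤x | m≥n⇒m⊓n≡n y≤x =
    trans (lemma y (x ∸ y)) (cong (_+ y) (m+[n∸m]≡n y≤x))
    where
    lemma : ∀ y d → 2 * y + d ≡ (y + d) + y
    lemma = solve-∀

  -- With d = |x - y|, twice the minimum is x + y - d, and d is traded for its square by 2dt ≤ d² +
  -- t². The parameter `t` stays free until n is chosen.
  ⊓-lower-bound : ∀ t x y → 2 * t * (x + y) ≤ 4 * t * (x ⊓ y) + ∣ x - y ∣ * ∣ x - y ∣ + t * t
  ⊓-lower-bound t x y = begin
    2 * t * (x + y)                 ≡⟨ cong (2 * t *_) (2⊓+∣-∣≡ x y) ⟨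
    2 * t * (2 * (x ⊓ y) + d)       ≡⟨ lemma t (x ⊓ y) d ⟩
    4 * t * (x ⊓ y) + 2 * (d * t)
      -- The only inequality of the chain: the square of d - t is nonnegative.
      ≤⟨ +-monoʳ-≤ (4 * t * (x ⊓ y)) (m≤n+m (2 * (d * t)) (∣ d - t ∣ * ∣ d - t ∣)) ⟩
    4 * t * (x ⊓ y) + (∣ d - t ∣ * ∣ d - t ∣ + 2 * (d * t))
                                    ≡⟨ cong (4 * t * (x ⊓ y) +_) (∣-∣²+2*≡ d t) ⟩
    4 * t * (x ⊓ y) + (d * d + t * t) ≡⟨ +-assoc (4 * t * (x ⊓ y)) (d * d) (t * t) ⟨
    4 * t * (x ⊓ y) + d * d + t * t ∎
    where
    open ≤-Reasoning
    d : ℕ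
    d = ∣ x - y ∣
    lemma : ∀ t x d → 2 * t * (2 * x + d) ≡ 4 * t * x + 2 * (d * t)
    lemma = solve-∀

  ∣++∣ : ∀ {k l} (A : Subset k) (B : Subset l) → ∣ A ++ B ∣ ≡ ∣ A ∣ + ∣ B ∣
  ∣++∣ []            B = refl
  ∣++∣ (inside ∷ A)  B = cong suc (∣++∣ A B)
  ∣++∣ (outside ∷ A) B = ∣++∣ A B

  ∣∣-variance : ∀ m c → 4 * total m (λ T → ∣ ∣ T ∣ - c ∣ * ∣ ∣ T ∣ - c ∣) + 4 * c * (m * 2 ^ m)
    ≡ (m * m + m + 4 * (c * c)) * 2 ^ m
  ∣∣-variance m c = begin
    4 * v + 4 * c * (m * 2 ^ m)        ≡⟨ cong (λ s → 4 * v + 4 * c * s) (total-∣∣ m) ⟨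
    4 * v + 4 * c * (2 * s)            ≡⟨ lemma₁ v c s ⟩
    4 * (v + 2 * c * s)
      ≡⟨ cong (4 *_) (trans (total-+ m _ (λ T → 2 * c * ∣ T ∣)) (cong (v +_) (total-* m (2 * c) ∣_∣))) ⟨
    4 * total m (λ T → ∣ ∣ T ∣ - c ∣ * ∣ ∣ T ∣ - c ∣ + 2 * c * ∣ T ∣)
      ≡⟨ cong (4 *_) (total-cong m λ T →
           trans (cong (∣ ∣ T ∣ - c ∣ * ∣ ∣ T ∣ - c ∣ +_) (lemma₂ c ∣ T ∣)) (∣-∣²+2*≡ ∣ T ∣ c)) ⟩
    4 * total m (λ T → ∣ T ∣ * ∣ T ∣ + c * c)
      ≡⟨ cong (4 *_) (trans (total-+ m _ (λ _ → c * c)) (cong (q +_) (total-const m (c * c)))) ⟩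
    4 * (q + 2 ^ m * (c * c))          ≡⟨ *-distribˡ-+ 4 q _ ⟩
    4 * q + 4 * (2 ^ m * (c * c))      ≡⟨ cong (_+ 4 * (2 ^ m * (c * c))) (total-∣∣² m) ⟩
    (m * m + m) * 2 ^ m + 4 * (2 ^ m * (c * c)) ≡⟨ lemma₃ m (2 ^ m) c ⟩
    (m * m + m + 4 * (c * c)) * 2 ^ m ∎
    where
    open ≡-Reasoning
    v s q : ℕ
    v = total m (λ T → ∣ ∣ T ∣ - c ∣ * ∣ ∣ T ∣ - c ∣)
    s = total m ∣_∣
    q = total m (λ T → ∣ T ∣ * ∣ T ∣)
    lemma₁ : ∀ v c s → 4 * v + 4 * c * (2 * s) ≡ 4 * (v + 2 * c * s)
    lemma₁ = solve-∀
    lemma₂ : ∀ c x → 2 * c * x ≡ 2 * (x * c)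
    lemma₂ = solve-∀
    lemma₃ : ∀ m N c → (m * m + m) * N + 4 * (N * (c * c)) ≡ (m * m + m + 4 * (c * c)) * N
    lemma₃ = solve-∀

  -- Complementing B turns the difference of the two sizes into the deviation of
  -- ∣ A ++ B ∣ from its mean n.
  ∣-∣-∁ : ∀ {n} (A B : Subset n) → ∣ ∣ A ∣ - ∣ ∁ B ∣ ∣ ≡ ∣ ∣ A ++ B ∣ - n ∣
  ∣-∣-∁ {n} A B = begin
    ∣ ∣ A ∣ - ∣ ∁ B ∣ ∣                     ≡⟨ cong (∣ ∣ A ∣ -_∣) (∣∁p∣≡n∸∣p∣ B) ⟩
    ∣ ∣ A ∣ - n ∸ ∣ B ∣ ∣                   ≡⟨ ∣m+n-m+o∣≡∣n-o∣ ∣ B ∣ ∣ A ∣ _ ⟨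
    ∣ ∣ B ∣ + ∣ A ∣ - ∣ B ∣ + (n ∸ ∣ B ∣) ∣ ≡⟨ cong₂ ∣_-_∣ (+-comm ∣ B ∣ ∣ A ∣) (m+[n∸m]≡n (∣p∣≤n B)) ⟩
    ∣ ∣ A ∣ + ∣ B ∣ - n ∣                   ≡⟨ cong (∣_- n ∣) (∣++∣ A B) ⟨
    ∣ ∣ A ++ B ∣ - n ∣                     ∎
    where open ≡-Reasoning

  -- Complementing `B` permutes the summands, so the double sum is the second moment of a fair
  -- binomial variable on 2n coins about its mean n, that is, its variance n/2.
  total-∣-∣² : ∀ n →
    2 * total n (λ A → total n (λ B → ∣ ∣ A ∣ - ∣ B ∣ ∣ * ∣ ∣ A ∣ - ∣ B ∣ ∣)) ≡ n * 2 ^ (n + n)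
  -- Doubling and adding the cross term gives `∣∣-variance` at `m = n + n` and `c = n`.
  total-∣-∣² n = *-cancelˡ-≡ _ _ 2 (+-cancelʳ-≡ (4 * n * ((n + n) * N)) _ _ (begin
    2 * (2 * v) + 4 * n * ((n + n) * N)
      ≡⟨ cong (_+ 4 * n * ((n + n) * N)) (trans (sym (*-assoc 2 2 v)) (cong (4 *_) v≡w)) ⟩
    4 * w + 4 * n * ((n + n) * N)       ≡⟨ ∣∣-variance (n + n) n ⟩
    ((n + n) * (n + n) + (n + n) + 4 * (n * n)) * N ≡⟨ lemma n N ⟩
    2 * (n * N) + 4 * n * ((n + n) * N) ∎))
    where
    open ≡-Reasoning
    N v w : ℕ
    N = 2 ^ (n + n)
    v = total n (λ A → total n (λ B → ∣ ∣ A ∣ - ∣ B ∣ ∣ * ∣ ∣ A ∣ - ∣ B ∣ ∣))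
    w = total (n + n) (λ T → ∣ ∣ T ∣ - n ∣ * ∣ ∣ T ∣ - n ∣)
    v≡w : v ≡ w
    v≡w = trans
      (total-cong n λ A → trans (sym (total-∁ n _))
        (total-cong n λ B → cong₂ _*_ (∣-∣-∁ A B) (∣-∣-∁ A B)))
      (sym (total-++ n n _))
    lemma : ∀ n N → ((n + n) * (n + n) + (n + n) + 4 * (n * n)) * N
      ≡ 2 * (n * N) + 4 * n * ((n + n) * N)
    lemma = solve-∀

  -- For positive t, division by 8t · 2^(2n) turns this into E min(a, b) ≥ n/2 - n/(8t) - t/4.
  total-⊓-lower-bound : ∀ t n →
    4 * t * (n * 2 ^ (n + n))
    ≤ 8 * t * total n (λ A → total n (λ B → ∣ A ∣ ⊓ ∣ B ∣)) + n * 2 ^ (n + n) + 2 * (t * t) * 2 ^ (n + n)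
  total-⊓-lower-bound t n = begin
    4 * t * (n * N) ≡⟨ lemma₁ t n N ⟩
    2 * t * ((n + n) * N) ≡⟨ cong (2 * t *_) (total-∣∣ (n + n)) ⟨
    2 * t * (2 * total (n + n) ∣_∣) ≡⟨ lemma₂ t _ ⟩
    2 * (2 * t * total (n + n) ∣_∣) ≡⟨ cong (2 *_) (total-* (n + n) (2 * t) ∣_∣) ⟨
    2 * total (n + n) (λ T → 2 * t * ∣ T ∣) ≡⟨ cong (2 *_) (total-++ n n _) ⟩
    2 * Σ² (λ A B → 2 * t * ∣ A ++ B ∣)
      ≤⟨ *-monoʳ-≤ 2 (total-mono n λ A → total-mono n λ B →
           ≤-trans (≤-reflexive (cong (2 * t *_) (∣++∣ A B))) (⊓-lower-bound t ∣ A ∣ ∣ B ∣)) ⟩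
    2 * Σ² (λ A B → 4 * t * (∣ A ∣ ⊓ ∣ B ∣) + D A B + t * t)
      ≡⟨ cong (2 *_) (trans (Σ²-+ _ _)
           (cong₂ _+_ (trans (Σ²-+ _ _) (cong (_+ Σ² D) (Σ²-* (4 * t) _))) Σ²-const)) ⟩
    2 * (4 * t * Σ² (λ A B → ∣ A ∣ ⊓ ∣ B ∣) + Σ² D + N * (t * t))
      ≡⟨ lemma₃ t (Σ² (λ A B → ∣ A ∣ ⊓ ∣ B ∣)) (Σ² D) N ⟩
    8 * t * Σ² (λ A B → ∣ A ∣ ⊓ ∣ B ∣) + 2 * Σ² D + 2 * (t * t) * N
      ≡⟨ cong (λ s → 8 * t * Σ² (λ A B → ∣ A ∣ ⊓ ∣ B ∣) + s + 2 * (t * t) * N) (total-∣-∣² n) ⟩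
    8 * t * Σ² (λ A B → ∣ A ∣ ⊓ ∣ B ∣) + n * N + 2 * (t * t) * N ∎
    where
    open ≤-Reasoning
    N : ℕ
    N = 2 ^ (n + n)
    Σ² : (Subset n → Subset n → ℕ) → ℕ
    Σ² X = total n (λ A → total n (X A))
    D : Subset n → Subset n → ℕ
    D A B = ∣ ∣ A ∣ - ∣ B ∣ ∣ * ∣ ∣ A ∣ - ∣ B ∣ ∣
    Σ²-+ : ∀ X Y → Σ² (λ A B → X A B + Y A B) ≡ Σ² X + Σ² Y
    Σ²-+ X Y = trans (total-cong n λ A → total-+ n (X A) (Y A)) (total-+ n _ _)
    Σ²-* : ∀ c X → Σ² (λ A B → c * X A B) ≡ c * Σ² X
    Σ²-* c X = trans (total-cong n λ A → total-* n c (X A)) (total-* n c _)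
    Σ²-const : Σ² (λ _ _ → t * t) ≡ N * (t * t)
    Σ²-const = trans (sym (total-++ n n (λ _ → t * t))) (total-const (n + n) (t * t))
    lemma₁ : ∀ t n N → 4 * t * (n * N) ≡ 2 * t * ((n + n) * N)
    lemma₁ = solve-∀
    lemma₂ : ∀ t s → 2 * t * (2 * s) ≡ 2 * (2 * t * s)
    lemma₂ = solve-∀
    lemma₃ : ∀ t μ D N → 2 * (4 * t * μ + D + N * (t * t)) ≡ 8 * t * μ + 2 * D + 2 * (t * t) * N
    lemma₃ = solve-∀

module Corona where
  open SubsetSums
  open CommutativeSemigroup using (xy∙z≈xz∙y)
  open import Data.Bool.Base using (Bool; true; false; _∧_)
  open import Data.Fin.Base using (_↑ˡ_; _↑ʳ_; splitAt; join; combine; remQuot)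
  import Data.Fin.Properties as Fin
  open import Data.Fin.Subset using (⊥; ⊤; ⁅_⁆; _∪_; _∈_; _⊆_)
  open import Data.List.Base using (length; tabulate)
  open import Data.List.Extrema.Nat using (v≤max⁺)
  open import Data.List.Membership.Propositional using (lose) renaming (_∈_ to _∈ˡ_)
  open import Data.List.Membership.Propositional.Properties
    using (∈-tabulate⁻; ∈-++⁺ˡ; ∈-++⁺ʳ; ∈-++⁻; ∈-map⁺; ∈-map⁻; ∈-filter⁺)
  open import Data.List.Relation.Binary.Permutation.Propositional using (↭-reflexive)
  import Data.List.Relation.Unary.All as All
  import Data.List.Relation.Unary.All.Properties as All
  open import Data.List.Relation.Unary.AllPairs using ([]; _∷_)
  open import Data.List.Relation.Unary.Any using (here; there)
  open import Data.List.Relation.Unary.Unique.Propositional using (Unique)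
  import Data.List.Relation.Unary.Unique.Propositional.Properties as Unique
  open import Data.Nat.Base
  open import Data.Nat.Properties
  import Data.Sum.Base as Sum
  open import Data.Sum.Base using (_⊎_; [_,_]′)
  import Data.Vec.Base as Vec
  import Data.Vec.Properties as Vec
  open import Function.Base using (id)
  open import Relation.Nullary using (¬_; Dec; yes; no; does; contradiction)
  open import Relation.Nullary.Decidable using (_×-dec_)
  open ≡ hiding ([_])

  ⊔+⊓≡+ : ∀ x y → (x ⊔ y) + (x ⊓ y) ≡ x + y
  ⊔+⊓≡+ x y with ≤-total x y
  ... | inj₁ x≤y rewrite m≤n⇒m⊔n≡n x≤y | m≤n⇒m⊓n≡m x≤y = +-comm y x
  ... | inj₂ y≤x rewrite m≥n⇒m⊔n≡m y≤x | m≥n⇒m⊓n≡n y≤x = refl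

  -- Counting subsets through repetition-free lists.

  elements : ∀ {n} → Subset n → List (Fin n)
  elements []            = []
  elements (inside ∷ S)  = zero ∷ List.map suc (elements S)
  elements (outside ∷ S) = List.map suc (elements S)

  length-elements : ∀ {n} (S : Subset n) → length (elements S) ≡ ∣ S ∣
  length-elements []            = refl
  length-elements (inside ∷ S)  = cong suc (trans (List.length-map suc (elements S)) (length-elements S))
  length-elements (outside ∷ S) = trans (List.length-map suc (elements S)) (length-elements S)

  ∈-elements⁻ : ∀ {n} (S : Subset n) {x} → x ∈ˡ elements S → x ∈ S
  ∈-elements⁻ (inside ∷ S)  (here refl) = Vec.here
  ∈-elements⁻ (inside ∷ S)  (there x∈) with ∈-map⁻ suc x∈
  ... | _ , y∈ , refl = Vec.there (∈-elements⁻ S y∈)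
  ∈-elements⁻ (outside ∷ S) x∈ with ∈-map⁻ suc x∈
  ... | _ , y∈ , refl = Vec.there (∈-elements⁻ S y∈)

  elements-unique : ∀ {n} (S : Subset n) → Unique (elements S)
  elements-unique []            = []
  elements-unique (inside ∷ S)  =
    All.map⁺ (All.tabulate λ _ ()) ∷ Unique.map⁺ Fin.suc-injective (elements-unique S)
  elements-unique (outside ∷ S) = Unique.map⁺ Fin.suc-injective (elements-unique S)

  fromElements : ∀ {n} → List (Fin n) → Subset n
  fromElements = List.foldr (λ x S → ⁅ x ⁆ ∪ S) ⊥

  ∈-fromElements⁺ : ∀ {n} {x : Fin n} {xs} → x ∈ˡ xs → x ∈ fromElements xs
  ∈-fromElements⁺ {xs = y ∷ _} (here refl) = x∈p∪q⁺ (inj₁ (x∈⁅x⁆ y))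
  ∈-fromElements⁺              (there x∈)  = x∈p∪q⁺ (inj₂ (∈-fromElements⁺ x∈))

  ∈-fromElements⁻ : ∀ {n} {x : Fin n} xs → x ∈ fromElements xs → x ∈ˡ xs
  ∈-fromElements⁻ []       x∈ = ⊥-elim (∉⊥ x∈)
  ∈-fromElements⁻ (y ∷ xs) x∈ with x∈p∪q⁻ ⁅ y ⁆ _ x∈
  ... | inj₁ x∈⁅y⁆ = here (x∈⁅y⁆⇒x≡y y x∈⁅y⁆)
  ... | inj₂ x∈xs  = there (∈-fromElements⁻ xs x∈xs)

  length≤∣∣ : ∀ {n} {xs : List (Fin n)} {S} → Unique xs →
    (∀ {x} → x ∈ˡ xs → x ∈ S) → length xs ≤ ∣ S ∣
  length≤∣∣ []           xs⊆S = z≤n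
  length≤∣∣ (x∉xs ∷ xs!) xs⊆S = ≤-<-trans
    (length≤∣∣ xs! λ y∈xs → x∈p∧x≢y⇒x∈p-y (xs⊆S (there y∈xs)) (All.lookup x∉xs y∈xs ∘ sym))
    (x∈p⇒∣p-x∣<∣p∣ (xs⊆S (here refl)))

  -- Injectivity is asked for on the members only, because an endpoint map is injective on a
  -- matching but not on all edges.
  map-unique : ∀ {a b} {A : Set a} {B : Set b} (f : A → B) {xs} →
    (∀ {x y} → x ∈ˡ xs → y ∈ˡ xs → f x ≡ f y → x ≡ y) → Unique xs → Unique (List.map f xs)
  map-unique f inj []           = []
  map-unique f inj (x∉xs ∷ xs!) =
    All.map⁺ (All.tabulate λ y∈ fx≡fy → All.lookup x∉xs y∈ (inj (here refl) (there y∈) fx≡fy))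
    ∷ map-unique f (λ x∈ y∈ → inj (there x∈) (there y∈)) xs!

  -- The two lists of images, concatenated, have no repetition and so fit into `Fin n`. In the
  -- application `S` and `S′` are matchings and `f`, `g` choose an end of each edge.
  ∣∣+∣∣≤ : ∀ {m n} (S S′ : Subset m) (f g : Fin m → Fin n) →
    (∀ {x y} → x ∈ S → y ∈ S → f x ≡ f y → x ≡ y) →
    (∀ {x y} → x ∈ S′ → y ∈ S′ → g x ≡ g y → x ≡ y) →
    (∀ {x y} → x ∈ S → y ∈ S′ → f x ≢ g y) →
    ∣ S ∣ + ∣ S′ ∣ ≤ n
  ∣∣+∣∣≤ {n = n} S S′ f g f-inj g-inj f≢g = begin
    ∣ S ∣ + ∣ S′ ∣          ≡⟨ cong₂ _+_ (length-map-elements S f) (length-map-elements S′ g) ⟨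
    length xs + length ys  ≡⟨ List.length-++ xs ⟨
    length (xs List.++ ys) ≤⟨ length≤∣∣ unique (λ _ → ∈⊤) ⟩
    ∣ ⊤ {n} ∣              ≡⟨ ∣⊤∣≡n n ⟩
    n                      ∎
    where
    open ≤-Reasoning
    xs ys : List (Fin n)
    xs = List.map f (elements S)
    ys = List.map g (elements S′)
    length-map-elements : ∀ (S : Subset _) (f : Fin _ → Fin n) → length (List.map f (elements S)) ≡ ∣ S ∣
    length-map-elements S f = trans (List.length-map f (elements S)) (length-elements S)
    unique : Unique (xs List.++ ys)
    unique = Unique.++⁺
      (map-unique f (λ x∈ y∈ → f-inj (∈-elements⁻ S x∈) (∈-elements⁻ S y∈)) (elements-unique S))
      (map-unique g (λ x∈ y∈ → g-inj (∈-elements⁻ S′ x∈) (∈-elements⁻ S′ y∈)) (elements-unique S′))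
      disjoint
      where
      disjoint : ∀ {v} → ¬ (v ∈ˡ xs × v ∈ˡ ys)
      disjoint (v∈xs , v∈ys) with ∈-map⁻ f v∈xs | ∈-map⁻ g v∈ys
      ... | _ , x∈ , refl | _ , y∈ , eq = f≢g (∈-elements⁻ S x∈) (∈-elements⁻ S′ y∈) eq

  ∈-subsets : ∀ {n} (S : Subset n) → S ∈ˡ subsets n
  ∈-subsets []            = here refl
  ∈-subsets (inside ∷ S)  = ∈-++⁺ˡ (∈-map⁺ (inside ∷_) (∈-subsets S))
  ∈-subsets (outside ∷ S) = ∈-++⁺ʳ _ (∈-map⁺ (outside ∷_) (∈-subsets S))

  -- Invariants of a run on an arbitrary graph.

  module _ (G : BipartiteMultigraph) where
    open BipartiteMultigraph G

    ∣matching∣≤maxMatchingSize : ∀ {M S} → M ⊆ S → IsMatching M → ∣ M ∣ ≤ maxMatchingSize G S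
    ∣matching∣≤maxMatchingSize {M} {S} M⊆S matching = v≤max⁺ 0 _ (inj₂ (lose
      (∈-map⁺ ∣_∣ (∈-filter⁺ (λ M → (M ⊆? S) ×-dec isMatching? M) (∈-subsets M) (M⊆S , matching)))
      ≤-refl))

    module _ (d : DeterministicPolicy G) where

      -- This is `M′` from `run`, with the realization flag as an argument so that it can be split
      -- on.
      accept : Bool → History G → EdgeSet → Edge → EdgeSet
      accept realized h M e =
        if realized ∧ d h e ∧ does (isMatching? (M ∪ ⁅ e ⁆)) then M ∪ ⁅ e ⁆ else M

      accept-⊇ : ∀ r h M e → M ⊆ accept r h M e
      accept-⊇ r h M e x∈M with r ∧ d h e ∧ does (isMatching? (M ∪ ⁅ e ⁆))
      ... | true  = p⊆p∪q ⁅ e ⁆ x∈M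
      ... | false = x∈M

      accept-⊆ : ∀ r h M e {x} → x ∈ accept r h M e → x ∈ M ⊎ (x ≡ e × r ≡ inside)
      accept-⊆ false h M e x∈ = inj₁ x∈
      accept-⊆ true h M e x∈ with d h e ∧ does (isMatching? (M ∪ ⁅ e ⁆))
      ... | true  = Sum.map₂ (λ x∈⁅e⁆ → x∈⁅y⁆⇒x≡y e x∈⁅e⁆ , refl) (x∈p∪q⁻ M ⁅ e ⁆ x∈)
      ... | false = inj₁ x∈

      accept-matching : ∀ r h M e → IsMatching M → IsMatching (accept r h M e)
      accept-matching false h M e matching = matching
      accept-matching true  h M e matching with d h e
      ... | false = matching
      ... | true = if-matching (isMatching? (M ∪ ⁅ e ⁆))
        where
        if-matching : (matching? : Dec (IsMatching (M ∪ ⁅ e ⁆))) →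
          IsMatching (if does matching? then M ∪ ⁅ e ⁆ else M)
        if-matching (yes matching′) = matching′
        if-matching (no _)          = matching

      run-⊇ : ∀ S h M es → M ⊆ run G d S h M es
      run-⊇ S h M []       x∈ = x∈
      run-⊇ S h M (e ∷ es) x∈ = run-⊇ S _ _ es (accept-⊇ (lookup S e) h M e x∈)

      run-⊆ : ∀ S h M es {x} → x ∈ run G d S h M es → x ∈ M ⊎ (x ∈ˡ es × x ∈ S)
      run-⊆ S h M []       x∈ = inj₁ x∈
      run-⊆ S h M (e ∷ es) x∈ with run-⊆ S _ _ es x∈
      ... | inj₂ (x∈es , x∈S) = inj₂ (there x∈es , x∈S)
      ... | inj₁ x∈M′ with accept-⊆ (lookup S e) h M e x∈M′
      ...   | inj₁ x∈M          = inj₁ x∈M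
      ...   | inj₂ (refl , S[e]) = inj₂ (here refl , Vec.lookup⇒[]= e S S[e])

      run-matching : ∀ S h M es → IsMatching M → IsMatching (run G d S h M es)
      run-matching S h M []       matching = matching
      run-matching S h M (e ∷ es) matching =
        run-matching S _ _ es (accept-matching (lookup S e) h M e matching)

      -- The online restriction in the form used below: a run reads `S` only at the edges that
      -- arrive in it.
      run-cong : ∀ S S′ h M es → (∀ {e} → e ∈ˡ es → lookup S e ≡ lookup S′ e) →
        run G d S h M es ≡ run G d S′ h M es
      run-cong S S′ h M []       eq = refl
      run-cong S S′ h M (e ∷ es) eq rewrite eq {e} (here refl) = run-cong S S′ _ _ es (eq ∘ there)

      observe : EdgeSet → History G → List Edge → History G
      observe S h []       = h
      observe S h (e ∷ es) = observe S ((e , lookup S e) ∷ h) es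

      run-++ : ∀ S h M es fs →
        run G d S h M (es List.++ fs) ≡ run G d S (observe S h es) (run G d S h M es) fs
      run-++ S h M []       fs = refl
      run-++ S h M (e ∷ es) fs = run-++ S _ _ es fs

  tabulate-+ : ∀ {a} {A : Set a} k {l} (f : Fin (k + l) → A) →
    tabulate f ≡ tabulate (f ∘ (_↑ˡ l)) List.++ tabulate (f ∘ (k ↑ʳ_))
  tabulate-+ zero    f = refl
  tabulate-+ (suc k) f = cong (f zero ∷_) (tabulate-+ k (f ∘ suc))

  ∈-zipWith⁻ : ∀ {A B C : Set} (f : A → B → C) xs ys {z} → z ∈ˡ List.zipWith f xs ys →
    ∃₂ λ x y → (x , y) ∈ˡ List.zip xs ys × z ≡ f x y
  ∈-zipWith⁻ f (x ∷ xs) (y ∷ ys) (here refl) = x , y , here refl , refl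
  ∈-zipWith⁻ f (x ∷ xs) (y ∷ ys) (there z∈) with ∈-zipWith⁻ f xs ys z∈
  ... | x′ , y′ , xy∈ , eq = x′ , y′ , there xy∈ , eq

  ∈-zip⁻ : ∀ {A B : Set} (xs : List A) (ys : List B) {x y} → (x , y) ∈ˡ List.zip xs ys → x ∈ˡ xs × y ∈ˡ ys
  ∈-zip⁻ (x ∷ xs) (y ∷ ys) (here refl) = here refl , here refl
  ∈-zip⁻ (x ∷ xs) (y ∷ ys) (there xy∈) with ∈-zip⁻ xs ys xy∈
  ... | x∈ , y∈ = there x∈ , there y∈

  -- A repetition-free list, zipped with another, pairs each of its members at most once. This and
  -- its mirror image make the zipped core edges a matching.
  ∈-zip-injectiveˡ : ∀ {A B : Set} {xs : List A} {ys : List B} {x y y′} → Unique xs →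
    (x , y) ∈ˡ List.zip xs ys → (x , y′) ∈ˡ List.zip xs ys → y ≡ y′
  ∈-zip-injectiveˡ {xs = _ ∷ _} {ys = _ ∷ _} _         (here refl) (here refl) = refl
  ∈-zip-injectiveˡ {xs = _ ∷ _} {ys = _ ∷ _} (x∉ ∷ _)  (here refl) (there q) =
    contradiction refl (All.lookup x∉ (proj₁ (∈-zip⁻ _ _ q)))
  ∈-zip-injectiveˡ {xs = _ ∷ _} {ys = _ ∷ _} (x∉ ∷ _)  (there p)   (here refl) =
    contradiction refl (All.lookup x∉ (proj₁ (∈-zip⁻ _ _ p)))
  ∈-zip-injectiveˡ {xs = _ ∷ _} {ys = _ ∷ _} (_ ∷ xs!) (there p)   (there q)   = ∈-zip-injectiveˡ xs! p q

  ∈-zip-injectiveʳ : ∀ {A B : Set} {xs : List A} {ys : List B} {x x′ y} → Unique ys →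
    (x , y) ∈ˡ List.zip xs ys → (x′ , y) ∈ˡ List.zip xs ys → x ≡ x′
  ∈-zip-injectiveʳ {xs = _ ∷ _} {ys = _ ∷ _} _         (here refl) (here refl) = refl
  ∈-zip-injectiveʳ {xs = _ ∷ _} {ys = _ ∷ _} (y∉ ∷ _)  (here refl) (there q) =
    contradiction refl (All.lookup y∉ (proj₂ (∈-zip⁻ _ _ q)))
  ∈-zip-injectiveʳ {xs = _ ∷ _} {ys = _ ∷ _} (y∉ ∷ _)  (there p)   (here refl) =
    contradiction refl (All.lookup y∉ (proj₂ (∈-zip⁻ _ _ p)))
  ∈-zip-injectiveʳ {xs = _ ∷ _} {ys = _ ∷ _} (_ ∷ ys!) (there p)   (there q)   = ∈-zip-injectiveʳ ys! p q

  zipWith-unique : ∀ {A B C : Set} (f : A → B → C) → (∀ {x x′ y y′} → f x y ≡ f x′ y′ → x ≡ x′) →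
    ∀ {xs} ys → Unique xs → Unique (List.zipWith f xs ys)
  zipWith-unique f inj ys []             = subst Unique (sym (List.zipWith-zeroˡ f ys)) []
  zipWith-unique f inj []       (_ ∷ _) = []
  zipWith-unique f inj {x ∷ xs} (y ∷ ys) (x∉ ∷ xs!) =
    All.tabulate fresh ∷ zipWith-unique f inj ys xs!
    where
    fresh : ∀ {z} → z ∈ˡ List.zipWith f xs ys → f x y ≢ z
    fresh z∈ eq with ∈-zipWith⁻ f xs ys z∈
    ... | _ , _ , p , refl = All.lookup x∉ (proj₁ (∈-zip⁻ xs ys p)) (inj eq)

  -- The corona of the complete bipartite graph.

  module _ (n : ℕ) where

    opposite : Fin (n + n) → Fin (n + n)
    opposite v = join n n (Sum.swap (splitAt n v))

    opposite-↑ˡ : ∀ i → opposite (i ↑ˡ n) ≡ n ↑ʳ i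
    opposite-↑ˡ i rewrite Fin.splitAt-↑ˡ n i n = refl

    opposite-↑ʳ : ∀ i → opposite (n ↑ʳ i) ≡ i ↑ˡ n
    opposite-↑ʳ i rewrite Fin.splitAt-↑ʳ n n i = refl

    opposite-involutive : ∀ v → opposite (opposite v) ≡ v
    opposite-involutive v with splitAt n v in eq
    ... | inj₁ i = trans (opposite-↑ʳ i) (Fin.splitAt⁻¹-↑ˡ eq)
    ... | inj₂ i = trans (opposite-↑ˡ i) (Fin.splitAt⁻¹-↑ʳ eq)

    opposite-injective : ∀ {v w} → opposite v ≡ opposite w → v ≡ w
    opposite-injective {v} {w} eq =
      trans (sym (opposite-involutive v)) (trans (cong opposite eq) (opposite-involutive w))

  ↑ˡ≢↑ʳ : ∀ {k l} {i : Fin k} {j : Fin l} → i ↑ˡ l ≢ k ↑ʳ j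
  ↑ˡ≢↑ʳ {k} {l} {i} {j} eq
    with trans (sym (Fin.splitAt-↑ˡ k i l)) (trans (cong (splitAt k) eq) (Fin.splitAt-↑ʳ k l j))
  ... | ()

  -- The complete bipartite graph on n + n vertices with a pendant edge at every
  -- vertex.  Vertex v : Fin (n + n) of either side is a core vertex if v = i ↑ˡ n
  -- and a leaf if v = n ↑ʳ i; pendant v joins v on the left to opposite v on the
  -- right, so that it is attached to a left core vertex in the first case and to
  -- a right one in the second.
  coronaGraph : ℕ → BipartiteMultigraph
  coronaGraph n = record
    { #L    = n + n
    ; #R    = n + n
    ; #E    = n * n + (n + n)
    ; left  = [ (λ c → proj₁ (remQuot n c) ↑ˡ n) , id ]′ ∘ splitAt (n * n)
    ; right = [ (λ c → proj₂ (remQuot {n} n c) ↑ˡ n) , opposite n ]′ ∘ splitAt (n * n)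
    }

  module _ {n : ℕ} where
    open BipartiteMultigraph (coronaGraph n)

    core : Fin n → Fin n → Edge
    core i j = combine i j ↑ˡ (n + n)

    pendant : Fin (n + n) → Edge
    pendant v = n * n ↑ʳ v

    data EdgeView : Edge → Set where
      isCore    : ∀ i j → EdgeView (core i j)
      isPendant : ∀ v → EdgeView (pendant v)

    edgeView : ∀ e → EdgeView e
    edgeView e with splitAt (n * n) e in eq
    ... | inj₁ c = subst EdgeView
      (trans (cong (_↑ˡ (n + n)) (Fin.combine-remQuot {n} n c)) (Fin.splitAt⁻¹-↑ˡ eq))
      (isCore (proj₁ (remQuot n c)) (proj₂ (remQuot {n} n c)))
    ... | inj₂ v = subst EdgeView (Fin.splitAt⁻¹-↑ʳ eq) (isPendant v)

    left-core : ∀ i j → left (core i j) ≡ i ↑ˡ n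
    left-core i j rewrite Fin.splitAt-↑ˡ (n * n) (combine i j) (n + n) =
      cong (λ ij → proj₁ ij ↑ˡ n) (Fin.remQuot-combine i j)

    right-core : ∀ i j → right (core i j) ≡ j ↑ˡ n
    right-core i j rewrite Fin.splitAt-↑ˡ (n * n) (combine i j) (n + n) =
      cong (λ ij → proj₂ ij ↑ˡ n) (Fin.remQuot-combine i j)

    left-pendant : ∀ v → left (pendant v) ≡ v
    left-pendant v rewrite Fin.splitAt-↑ʳ (n * n) (n + n) v = refl

    right-pendant : ∀ v → right (pendant v) ≡ opposite n v
    right-pendant v rewrite Fin.splitAt-↑ʳ (n * n) (n + n) v = refl

    realization : Subset (n + n) → EdgeSet
    realization T = replicate (n * n) inside ++ T

    core∈realization : ∀ {T} i j → core i j ∈ realization T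
    core∈realization {T} i j = Vec.lookup⇒[]= (core i j) (realization T)
      (trans (Vec.lookup-++ˡ (replicate (n * n) inside) T (combine i j))
        (Vec.lookup-replicate (combine i j) inside))

    pendant∈realization⁺ : ∀ {T v} → v ∈ T → pendant v ∈ realization T
    pendant∈realization⁺ {T} {v} v∈T = Vec.lookup⇒[]= (pendant v) (realization T)
      (trans (Vec.lookup-++ʳ (replicate (n * n) inside) T v) (Vec.[]=⇒lookup v∈T))

    pendant∈realization⁻ : ∀ {T v} → pendant v ∈ realization T → v ∈ T
    pendant∈realization⁻ {T} {v} v∈ = Vec.lookup⇒[]= v T
      (trans (sym (Vec.lookup-++ʳ (replicate (n * n) inside) T v)) (Vec.[]=⇒lookup v∈))

    coreEdges pendantEdges : List Edge
    coreEdges    = tabulate {n = n * n} (_↑ˡ (n + n))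
    pendantEdges = tabulate {n = n + n} (n * n ↑ʳ_)

    coreFirst : ArrivalOrder (coronaGraph n)
    coreFirst = coreEdges List.++ pendantEdges , ↭-reflexive (sym (tabulate-+ (n * n) id))

    core≢pendant : ∀ {i j v} → core i j ≢ pendant v
    core≢pendant = ↑ˡ≢↑ʳ

    -- Upper bound for deterministic policies.

    module _ (d : DeterministicPolicy (coronaGraph n)) where

      -- The pendant part `⊥` is an arbitrary choice: all realizations considered agree on the core,
      -- so each of them leads to this matching.
      afterCore : EdgeSet
      afterCore = run (coronaGraph n) d (realization ⊥) [] ⊥ coreEdges

      result : Subset (n + n) → EdgeSet
      result T = outcome (coronaGraph n) d coreFirst (realization T)

      result≡ : ∀ T → result T ≡ run (coronaGraph n) d (realization T)
        (observe (coronaGraph n) d (realization T) [] coreEdges) afterCore pendantEdges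
      result≡ T = trans (run-++ (coronaGraph n) d (realization T) [] ⊥ coreEdges pendantEdges)
        (cong (λ M → run (coronaGraph n) d (realization T)
                (observe (coronaGraph n) d (realization T) [] coreEdges) M pendantEdges)
          (run-cong (coronaGraph n) d (realization T) (realization ⊥) [] ⊥ coreEdges agree))
        where
        agree : ∀ {e} → e ∈ˡ coreEdges → lookup (realization T) e ≡ lookup (realization ⊥) e
        agree e∈ with ∈-tabulate⁻ {n = n * n} {f = _↑ˡ (n + n)} e∈
        ... | c , refl = trans (Vec.lookup-++ˡ (replicate (n * n) inside) T c)
          (sym (Vec.lookup-++ˡ (replicate (n * n) inside) ⊥ c))

      result-matching : ∀ T → IsMatching (result T)
      result-matching T =
        run-matching (coronaGraph n) d (realization T) [] ⊥ (coreEdges List.++ pendantEdges)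
          (λ _ _ e∈⊥ → ⊥-elim (∉⊥ e∈⊥))

      pendant∈result : ∀ T {v} → pendant v ∈ result T → v ∈ T
      pendant∈result T v∈
        with run-⊆ (coronaGraph n) d (realization T) [] ⊥ (coreEdges List.++ pendantEdges) v∈
      ... | inj₁ v∈⊥       = ⊥-elim (∉⊥ v∈⊥)
      ... | inj₂ (_ , v∈R) = pendant∈realization⁻ v∈R

      -- Core edges can enter only during the core phase, whose outcome `afterCore` is common to all
      -- `T`; the pendant phase adds pendant edges alone and removes nothing.
      core∈result : ∀ T T′ {i j} → core i j ∈ result T → core i j ∈ result T′
      core∈result T T′ c∈ rewrite result≡ T | result≡ T′
        with run-⊆ (coronaGraph n) d (realization T) _ afterCore pendantEdges c∈
      ... | inj₁ c∈M = run-⊇ (coronaGraph n) d (realization T′) _ afterCore pendantEdges c∈M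
      ... | inj₂ (c∈pendant , _) with ∈-tabulate⁻ {n = n + n} {f = n * n ↑ʳ_} c∈pendant
      ...   | _ , eq = ⊥-elim (core≢pendant eq)

      -- Charge each edge of result T to its left end, and each edge of
      -- result (∁ T) to the vertex opposite to its right end.  No vertex is charged
      -- twice, as the two runs agree on the core and share no pendant edge.
      ∣result∣+∣result-∁∣≤ : ∀ T → ∣ result T ∣ + ∣ result (∁ T) ∣ ≤ n + n
      ∣result∣+∣result-∁∣≤ T = ∣∣+∣∣≤ (result T) (result (∁ T)) left (opposite n ∘ right)
        (λ e∈ f∈ eq → result-matching T _ _ e∈ f∈ (inj₁ eq))
        (λ e∈ f∈ eq → result-matching (∁ T) _ _ e∈ f∈ (inj₂ (opposite-injective n eq)))
        (λ {e} {f} → distinct (edgeView e) (edgeView f))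
        where
        distinct : ∀ {e f} → EdgeView e → EdgeView f → e ∈ result T → f ∈ result (∁ T) →
          left e ≢ opposite n (right f)
        -- Two core edges are charged to different halves: the first to a core vertex, the second to
        -- a leaf.
        distinct (isCore i j) (isCore i′ j′) e∈ f∈ eq = ↑ˡ≢↑ʳ (begin
          i ↑ˡ n                          ≡⟨ left-core i j ⟨
          left (core i j)                 ≡⟨ eq ⟩
          opposite n (right (core i′ j′)) ≡⟨ cong (opposite n) (right-core i′ j′) ⟩
          opposite n (j′ ↑ˡ n)            ≡⟨ opposite-↑ˡ n j′ ⟩
          n ↑ʳ j′                         ∎)
          where open ≡-Reasoning
        -- The core edge also lies in `result (∁ T)`, where it would meet `pendant v` at its left
        -- end. The next case is the same conflict at the right end, inside `result T`.
        distinct (isCore i j) (isPendant v) e∈ f∈ eq = core≢pendant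
          (result-matching (∁ T) _ _ (core∈result T (∁ T) e∈) f∈ (inj₁ (begin
            left (core i j)                ≡⟨ eq ⟩
            opposite n (right (pendant v)) ≡⟨ cong (opposite n) (right-pendant v) ⟩
            opposite n (opposite n v)      ≡⟨ opposite-involutive n v ⟩
            v                              ≡⟨ left-pendant v ⟨
            left (pendant v)               ∎)))
          where open ≡-Reasoning
        distinct (isPendant v) (isCore i j) e∈ f∈ eq = core≢pendant
          (result-matching T _ _ (core∈result (∁ T) T f∈) e∈ (inj₂ (begin
            right (core i j)                           ≡⟨ opposite-involutive n _ ⟨
            opposite n (opposite n (right (core i j))) ≡⟨ cong (opposite n) eq ⟨
            opposite n (left (pendant v))              ≡⟨ cong (opposite n) (left-pendant v) ⟩
            opposite n v                               ≡⟨ right-pendant v ⟨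
            right (pendant v)                          ∎)))
          where open ≡-Reasoning
        distinct (isPendant v) (isPendant w) e∈ f∈ eq =
          x∈p⇒x∉∁p (pendant∈result T e∈) (subst (_∈ ∁ T) (sym v≡w) (pendant∈result (∁ T) f∈))
          where
          v≡w : v ≡ w
          v≡w = trans (sym (left-pendant v))
            (trans eq (trans (cong (opposite n) (right-pendant w)) (opposite-involutive n w)))

      -- Complementation permutes the subsets, so twice the sum is a sum over pairs `T`, `∁ T`, each
      -- at most 2n.
      total-∣result∣≤ : total (n + n) (∣_∣ ∘ result) ≤ n * 2 ^ (n + n)
      total-∣result∣≤ = *-cancelˡ-≤ 2 (begin
        2 * Σ∣result∣                                ≡⟨ cong (Σ∣result∣ +_) (+-identityʳ Σ∣result∣) ⟩
        Σ∣result∣ + Σ∣result∣                        ≡⟨ cong (Σ∣result∣ +_) (total-∁ (n + n) (∣_∣ ∘ result)) ⟨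
        Σ∣result∣ + total (n + n) (∣_∣ ∘ result ∘ ∁) ≡⟨ total-+ (n + n) (∣_∣ ∘ result) _ ⟨
        total (n + n) (λ T → ∣ result T ∣ + ∣ result (∁ T) ∣)
                                                  ≤⟨ total-mono (n + n) ∣result∣+∣result-∁∣≤ ⟩
        total (n + n) (λ _ → n + n)               ≡⟨ total-const (n + n) (n + n) ⟩
        2 ^ (n + n) * (n + n)                     ≡⟨ lemma (2 ^ (n + n)) n ⟩
        2 * (n * 2 ^ (n + n))                     ∎)
        where
        open ≤-Reasoning
        Σ∣result∣ : ℕ
        Σ∣result∣ = total (n + n) (∣_∣ ∘ result)
        lemma : ∀ N n → N * (n + n) ≡ 2 * (n * N)
        lemma = solve-∀

    ↑ˡ∈++⁻ : ∀ {A B : Subset n} {i} → i ↑ˡ n ∈ A ++ B → i ∈ A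
    ↑ˡ∈++⁻ {A} {B} {i} i∈ = Vec.lookup⇒[]= i A (trans (sym (Vec.lookup-++ˡ A B i)) (Vec.[]=⇒lookup i∈))

    ↑ʳ∈++⁻ : ∀ {A B : Subset n} {i} → n ↑ʳ i ∈ A ++ B → i ∈ B
    ↑ʳ∈++⁻ {A} {B} {i} i∈ = Vec.lookup⇒[]= i B (trans (sym (Vec.lookup-++ʳ A B i)) (Vec.[]=⇒lookup i∈))

    -- A large matching in hindsight.

    module _ (A B : Subset n) where

      -- `A` and `B` are the left and right core vertices with a realized pendant edge. `zipWith`
      -- stops at the shorter list, so as many core vertices free of such edges are paired as the
      -- scarcer side allows.
      bestPendants bestCore bestEdges : List Edge
      bestPendants = List.map pendant (elements (A ++ B))
      bestCore     = List.zipWith core (elements (∁ A)) (elements (∁ B))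
      bestEdges    = bestPendants List.++ bestCore

      data Best : Edge → Set where
        realizedPendant : ∀ {v} → v ∈ A ++ B → Best (pendant v)
        freeCore : ∀ {i j} → (i , j) ∈ˡ List.zip (elements (∁ A)) (elements (∁ B)) → Best (core i j)

      best : ∀ {e} → e ∈ˡ bestEdges → Best e
      best e∈ with ∈-++⁻ bestPendants e∈
      ... | inj₁ e∈P with ∈-map⁻ pendant e∈P
      ...   | v , v∈ , refl = realizedPendant (∈-elements⁻ (A ++ B) v∈)
      best e∈ | inj₂ e∈C with ∈-zipWith⁻ core (elements (∁ A)) (elements (∁ B)) e∈C
      ...   | i , j , ij∈ , refl = freeCore ij∈

      best-realized : ∀ {e} → Best e → e ∈ realization (A ++ B)
      best-realized (realizedPendant v∈)    = pendant∈realization⁺ v∈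
      best-realized (freeCore {i} {j} _) = core∈realization i j

      -- The core end of a realized pendant edge lies in `A` or `B`, those of a chosen core edge in
      -- `∁ A` and `∁ B`; leaves meet no core edge.
      pendant-core-disjoint : ∀ {v i j} → v ∈ A ++ B →
        (i , j) ∈ˡ List.zip (elements (∁ A)) (elements (∁ B)) →
        ¬ ShareVertex (pendant v) (core i j)
      pendant-core-disjoint {v} {i} {j} v∈ ij∈ (inj₁ eq) =
        x∈p⇒x∉∁p (↑ˡ∈++⁻ (subst (_∈ A ++ B) v≡i v∈)) (∈-elements⁻ (∁ A) (proj₁ (∈-zip⁻ _ _ ij∈)))
        where
        v≡i : v ≡ i ↑ˡ n
        v≡i = trans (sym (left-pendant v)) (trans eq (left-core i j))
      pendant-core-disjoint {v} {i} {j} v∈ ij∈ (inj₂ eq) =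
        x∈p⇒x∉∁p (↑ʳ∈++⁻ {A} (subst (_∈ A ++ B) v≡j v∈)) (∈-elements⁻ (∁ B) (proj₂ (∈-zip⁻ _ _ ij∈)))
        where
        open ≡-Reasoning
        v≡j : v ≡ n ↑ʳ j
        v≡j = begin
          v                              ≡⟨ opposite-involutive n v ⟨
          opposite n (opposite n v)      ≡⟨ cong (opposite n) (right-pendant v) ⟨
          opposite n (right (pendant v)) ≡⟨ cong (opposite n) (trans eq (right-core i j)) ⟩
          opposite n (j ↑ˡ n)            ≡⟨ opposite-↑ˡ n j ⟩
          n ↑ʳ j                         ∎

      best-matching : ∀ {e f} → Best e → Best f → ShareVertex e f → e ≡ f
      best-matching (realizedPendant {v} _) (realizedPendant {w} _) (inj₁ eq) =
        cong pendant (trans (sym (left-pendant v)) (trans eq (left-pendant w)))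
      best-matching (realizedPendant {v} _) (realizedPendant {w} _) (inj₂ eq) =
        cong pendant (opposite-injective n (trans (sym (right-pendant v)) (trans eq (right-pendant w))))
      best-matching (realizedPendant v∈) (freeCore ij∈) share =
        ⊥-elim (pendant-core-disjoint v∈ ij∈ share)
      best-matching (freeCore ij∈) (realizedPendant v∈) share =
        ⊥-elim (pendant-core-disjoint v∈ ij∈ (Sum.map sym sym share))
      best-matching (freeCore {i} {j} ij∈) (freeCore {i′} {j′} ij∈′) (inj₁ eq)
        with Fin.↑ˡ-injective n i i′ (trans (sym (left-core i j)) (trans eq (left-core i′ j′)))
      ... | refl = cong (core i) (∈-zip-injectiveˡ (elements-unique (∁ A)) ij∈ ij∈′)
      best-matching (freeCore {i} {j} ij∈) (freeCore {i′} {j′} ij∈′) (inj₂ eq)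
        with Fin.↑ˡ-injective n j j′ (trans (sym (right-core i j)) (trans eq (right-core i′ j′)))
      ... | refl = cong (λ i → core i j) (∈-zip-injectiveʳ (elements-unique (∁ B)) ij∈ ij∈′)

      bestEdges-unique : Unique bestEdges
      bestEdges-unique = Unique.++⁺
        (Unique.map⁺ (Fin.↑ʳ-injective (n * n) _ _) (elements-unique (A ++ B)))
        (zipWith-unique core core-injectiveˡ (elements (∁ B)) (elements-unique (∁ A)))
        disjoint
        where
        core-injectiveˡ : ∀ {i i′ j j′} → core i j ≡ core i′ j′ → i ≡ i′
        core-injectiveˡ {i} {i′} {j} {j′} eq =
          Fin.combine-injectiveˡ i j i′ j′ (Fin.↑ˡ-injective (n + n) _ _ eq)
        disjoint : ∀ {e} → ¬ (e ∈ˡ bestPendants × e ∈ˡ bestCore)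
        disjoint (e∈P , e∈C)
          with ∈-map⁻ pendant e∈P | ∈-zipWith⁻ core (elements (∁ A)) (elements (∁ B)) e∈C
        ... | _ , _ , refl | _ , _ , _ , eq = core≢pendant (sym eq)

      length-bestEdges : length bestEdges ≡ n + ∣ A ∣ ⊓ ∣ B ∣
      length-bestEdges = begin
        length bestEdges ≡⟨ List.length-++ bestPendants ⟩
        length bestPendants + length bestCore
          ≡⟨ cong₂ _+_ (trans (List.length-map pendant (elements (A ++ B)))
                 (trans (length-elements (A ++ B)) (∣++∣ A B)))
               (trans (List.length-zipWith core (elements (∁ A)) (elements (∁ B)))
                 (cong₂ _⊓_ (length-∁ A) (length-∁ B))) ⟩
        -- The scarcer free side has `n ∸ (a ⊔ b)` vertices; splitting `a + b` into maximum and
        -- minimum cancels the maximum.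
        a + b + (n ∸ a) ⊓ (n ∸ b)   ≡⟨ cong (a + b +_) (∸-distribˡ-⊔-⊓ n a b) ⟨
        a + b + (n ∸ (a ⊔ b))       ≡⟨ cong (_+ (n ∸ (a ⊔ b))) (⊔+⊓≡+ a b) ⟨
        (a ⊔ b) + (a ⊓ b) + (n ∸ (a ⊔ b)) ≡⟨ xy∙z≈xz∙y +-commutativeSemigroup (a ⊔ b) (a ⊓ b) _ ⟩
        (a ⊔ b) + (n ∸ (a ⊔ b)) + (a ⊓ b)
          ≡⟨ cong (_+ (a ⊓ b)) (m+[n∸m]≡n (⊔-lub (∣p∣≤n A) (∣p∣≤n B))) ⟩
        n + a ⊓ b ∎
        where
        open ≡-Reasoning
        a b : ℕ
        a = ∣ A ∣
        b = ∣ B ∣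
        length-∁ : ∀ (S : Subset n) → length (elements (∁ S)) ≡ n ∸ ∣ S ∣
        length-∁ S = trans (length-elements (∁ S)) (∣∁p∣≡n∸∣p∣ S)

      maxMatchingSize≥ : n + ∣ A ∣ ⊓ ∣ B ∣ ≤ maxMatchingSize (coronaGraph n) (realization (A ++ B))
      maxMatchingSize≥ = begin
        n + ∣ A ∣ ⊓ ∣ B ∣          ≡⟨ length-bestEdges ⟨
        length bestEdges           ≤⟨ length≤∣∣ bestEdges-unique ∈-fromElements⁺ ⟩
        ∣ fromElements bestEdges ∣ ≤⟨ ∣matching∣≤maxMatchingSize (coronaGraph n)
          (λ e∈ → best-realized (best (∈-fromElements⁻ bestEdges e∈)))
          (λ e f e∈ f∈ → best-matching (best (∈-fromElements⁻ bestEdges e∈))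
            (best (∈-fromElements⁻ bestEdges f∈))) ⟩
        maxMatchingSize (coronaGraph n) (realization (A ++ B)) ∎
        where open ≤-Reasoning

    totalOPT : ℕ
    totalOPT = total (n + n) (λ T → maxMatchingSize (coronaGraph n) (realization T))

    totalOPT≥ : n * 2 ^ (n + n) + total n (λ A → total n (λ B → ∣ A ∣ ⊓ ∣ B ∣)) ≤ totalOPT
    totalOPT≥ = begin
      n * 2 ^ (n + n) + total n (λ A → total n (λ B → ∣ A ∣ ⊓ ∣ B ∣))
        ≡⟨ cong (_+ total n (λ A → total n (λ B → ∣ A ∣ ⊓ ∣ B ∣)))
             (trans (*-comm n _) (trans (sym (total-const (n + n) n)) (total-++ n n (λ _ → n)))) ⟩
      total n (λ A → total n (λ B → n)) + total n (λ A → total n (λ B → ∣ A ∣ ⊓ ∣ B ∣))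
        ≡⟨ trans (total-cong n λ A → total-+ n (λ _ → n) (λ B → ∣ A ∣ ⊓ ∣ B ∣)) (total-+ n _ _) ⟨
      total n (λ A → total n (λ B → n + ∣ A ∣ ⊓ ∣ B ∣))
        ≤⟨ total-mono n (λ A → total-mono n (λ B → maxMatchingSize≥ A B)) ⟩
      total n (λ A → total n (λ B → maxMatchingSize (coronaGraph n) (realization (A ++ B))))
        ≡⟨ total-++ n n _ ⟨
      totalOPT ∎
      where open ≤-Reasoning

  -- Up to the factor 2^(2n), the first field says that 2 OPT falls short of 3n by at most t, and
  -- the second that this shortfall is at most a 1/t fraction of OPT.
  record OPTBounds (t n : ℕ) : Set where
    field
      3nN≤2OPT+tN : 3 * (n * 2 ^ (n + n)) ≤ 2 * totalOPT {n} + t * 2 ^ (n + n)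
      t*tN≤OPT    : t * (t * 2 ^ (n + n)) ≤ totalOPT {n}
      0<tN        : 0 < t * 2 ^ (n + n)

  -- n = 2t² balances the terms E(a − b)² = n / 2 and t² of ⊓-lower-bound.
  module _ (t : ℕ) .{{_ : NonZero t}} where
    private
      n N OPT : ℕ
      n   = 2 * (t * t)
      N   = 2 ^ (n + n)
      OPT = totalOPT {n}

      3nN≤2OPT+tN : 3 * (n * N) ≤ 2 * OPT + t * N
      3nN≤2OPT+tN = *-cancelˡ-≤ (4 * t) {{m*n≢0 4 t}} (begin
        4 * t * (3 * (n * N))                     ≡⟨ lemma₁ t n N ⟩
        8 * t * (n * N) + 4 * t * (n * N)
          ≤⟨ +-monoʳ-≤ (8 * t * (n * N)) (total-⊓-lower-bound t n) ⟩
        8 * t * (n * N) + (8 * t * μ + n * N + 2 * (t * t) * N)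
          -- For this `n` both error terms equal 2t²N, together `4 * t * (t * N)`.
          ≡⟨ lemma₂ t N μ ⟩
        8 * t * (n * N + μ) + 4 * t * (t * N)
          ≤⟨ +-monoˡ-≤ (4 * t * (t * N)) (*-monoʳ-≤ (8 * t) (totalOPT≥ {n})) ⟩
        8 * t * OPT + 4 * t * (t * N)             ≡⟨ lemma₃ t OPT N ⟩
        4 * t * (2 * OPT + t * N)                 ∎)
        where
        open ≤-Reasoning
        μ : ℕ
        μ = total n (λ A → total n (λ B → ∣ A ∣ ⊓ ∣ B ∣))
        lemma₁ : ∀ t n N → 4 * t * (3 * (n * N)) ≡ 8 * t * (n * N) + 4 * t * (n * N)
        lemma₁ = solve-∀
        lemma₂ : ∀ t N μ →
          8 * t * (2 * (t * t) * N) + (8 * t * μ + 2 * (t * t) * N + 2 * (t * t) * N)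
          ≡ 8 * t * (2 * (t * t) * N + μ) + 4 * t * (t * N)
        lemma₂ = solve-∀
        lemma₃ : ∀ t P N → 8 * t * P + 4 * t * (t * N) ≡ 4 * t * (2 * P + t * N)
        lemma₃ = solve-∀

      t*tN≤OPT : t * (t * N) ≤ OPT
      t*tN≤OPT = begin
        t * (t * N) ≡⟨ *-assoc t t N ⟨
        t * t * N   ≤⟨ *-monoˡ-≤ N (m≤m+n (t * t) (t * t + 0)) ⟩
        n * N       ≤⟨ m≤m+n (n * N) _ ⟩
        n * N + _   ≤⟨ totalOPT≥ {n} ⟩
        OPT         ∎
        where open ≤-Reasoning

      0<tN : 0 < t * N
      0<tN = *-mono-≤ (>-nonZero⁻¹ t) (m^n>0 2 (n + n))

    optBounds : OPTBounds t (2 * (t * t))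
    optBounds = record { 3nN≤2OPT+tN = 3nN≤2OPT+tN ; t*tN≤OPT = t*tN≤OPT ; 0<tN = 0<tN }

open SubsetSums using (total)
open Corona

-- Order arithmetic in the field.

module _ {c ℓ₁ ℓ₂ ℓ₃} (F : ArchimedeanOrderedField c ℓ₁ ℓ₂ ℓ₃) where
  open ArchimedeanOrderedField F hiding (zero)
  open Model F
  open CommutativeRing commutativeRing using (semiring; *-commutativeSemigroup)
  open CommutativeSemigroup *-commutativeSemigroup using (x∙yz≈y∙xz)
  open IsStrictPartialOrder <-isStrictPartialOrder
    using (<-respˡ-≈; <-respʳ-≈) renaming (irrefl to <-irrefl; trans to <-trans; asym to <-asym)
  open Mult semiring using (×-homo-+; ×1-homo-*; ×-congˡ)
  open Sum +-commutativeMonoid using (sum)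
  open Sum *-commutativeMonoid using () renaming (sum to product)
  open Exp semiring using (_^_)
  open SemiringSum semiring using (*-distribʳ-sum)

  -- Cotransitivity replaces trichotomy: comparing `x` with y < z leaves y < x, which is excluded,
  -- or the claim.
  ≤-<-trans : ∀ {x y z} → x ≤ y → y < z → x < z
  ≤-<-trans {x} x≤y y<z with <-cotrans y<z x
  ... | inj₁ y<x = ⊥-elim (x≤y y<x)
  ... | inj₂ x<z = x<z

  <-≤-trans : ∀ {x y z} → x < y → y ≤ z → x < z
  <-≤-trans {z = z} x<y y≤z with <-cotrans x<y z
  ... | inj₁ x<z = x<z
  ... | inj₂ z<y = ⊥-elim (y≤z z<y)

  <⇒≤ : ∀ {x y} → x < y → x ≤ y
  <⇒≤ = <-asym

  ≤-reflexive : ∀ {x y} → x ≈ y → x ≤ y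
  ≤-reflexive x≈y y<x = <-irrefl (sym x≈y) y<x

  ≤-trans : ∀ {x y z} → x ≤ y → y ≤ z → x ≤ z
  ≤-trans x≤y y≤z z<x = y≤z (<-≤-trans z<x x≤y)

  ≤-respʳ-≈ : ∀ {x y z} → y ≈ z → x ≤ y → x ≤ z
  ≤-respʳ-≈ y≈z x≤y z<x = x≤y (<-respˡ-≈ (sym y≈z) z<x)

  ≤-respˡ-≈ : ∀ {x y z} → x ≈ y → x ≤ z → y ≤ z
  ≤-respˡ-≈ x≈y x≤z z<y = x≤z (<-respʳ-≈ (sym x≈y) z<y)

  +-cancelʳ-< : ∀ z {x y} → x + z < y + z → x < y
  +-cancelʳ-< z {x} {y} x+z<y+z =
    <-respˡ-≈ (cancel x) (<-respʳ-≈ (cancel y) (+-monoˡ-< (- z) x+z<y+z))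
    where
    cancel : ∀ x → x + z + - z ≈ x
    cancel x = Group.//-rightDividesʳ +-group z x

  +-cancelˡ-< : ∀ z {x y} → z + x < z + y → x < y
  +-cancelˡ-< z z+x<z+y = +-cancelʳ-< z (<-respˡ-≈ (+-comm z _) (<-respʳ-≈ (+-comm z _) z+x<z+y))

  +-monoʳ-< : ∀ z {x y} → x < y → z + x < z + y
  +-monoʳ-< z {x} {y} x<y = <-respˡ-≈ (+-comm x z) (<-respʳ-≈ (+-comm y z) (+-monoˡ-< z x<y))

  +-mono-≤ : ∀ {x y u v} → x ≤ y → u ≤ v → x + u ≤ y + v
  +-mono-≤ {x} {y} {u} {v} x≤y u≤v =
    ≤-trans {y = y + u} (λ y+u<x+u → x≤y (+-cancelʳ-< u y+u<x+u)) (λ y+v<y+u → u≤v (+-cancelˡ-< y y+v<y+u))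

  x<y⇒0<y-x : ∀ {x y} → x < y → 0# < y - x
  x<y⇒0<y-x {x} x<y = <-respˡ-≈ (-‿inverseʳ x) (+-monoˡ-< (- x) x<y)

  *-monoʳ-< : ∀ {z x y} → 0# < z → x < y → z * x < z * y
  *-monoʳ-< {z} {x} {y} 0<z x<y =
    <-respˡ-≈ (+-identityʳ (z * x)) (<-respʳ-≈ eq (+-monoʳ-< (z * x) (*-pos 0<z (x<y⇒0<y-x x<y))))
    where
    open ≈-Reasoning setoid
    eq : z * x + z * (y - x) ≈ z * y
    eq = begin
      z * x + z * (y - x) ≈⟨ distribˡ z x (y - x) ⟨
      z * (x + (y - x))   ≈⟨ *-congˡ (+-comm x (y - x)) ⟩
      z * (y - x + x)     ≈⟨ *-congˡ (Group.//-rightDividesˡ +-group x y) ⟩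
      z * y               ∎

  *-monoˡ-< : ∀ {z x y} → 0# < z → x < y → x * z < y * z
  *-monoˡ-< {z} {x} {y} 0<z x<y = <-respˡ-≈ (*-comm z x) (<-respʳ-≈ (*-comm z y) (*-monoʳ-< 0<z x<y))

  recip-inverseʳ : ∀ {x} (0<x : 0# < x) → x * recip x 0<x ≈ 1#
  recip-inverseʳ {x} 0<x = trans (*-congʳ (sym (HCR.x-0≈x heytingCommutativeRing x)))
    (proj₂ (proj₂ (#⇒invertible {x} {0#} (#-sym (<⇒# 0<x)))))

  recip-inverseˡ : ∀ {x} (0<x : 0# < x) → recip x 0<x * x ≈ 1#
  recip-inverseˡ 0<x = trans (*-comm _ _) (recip-inverseʳ 0<x)

  0<recip : ∀ {x} (0<x : 0# < x) → 0# < recip x 0<x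
  0<recip {x} 0<x with #⇒<⊎> recip#0
    where
    recip#0 : recip x 0<x # 0#
    recip#0 = HCR.invertibleʳ⇒# heytingCommutativeRing
      (x , trans (*-congʳ (HCR.x-0≈x heytingCommutativeRing _)) (recip-inverseˡ 0<x))
  ... | inj₂ 0<r = 0<r
  ... | inj₁ r<0 = ⊥-elim (<-asym 0<1
    (<-respˡ-≈ (recip-inverseʳ 0<x) (<-respʳ-≈ (zeroʳ x) (*-monoʳ-< 0<x r<0))))

  *-cancelˡ-< : ∀ {z x y} → 0# < z → z * x < z * y → x < y
  *-cancelˡ-< {z} {x} {y} 0<z zx<zy =
    <-respˡ-≈ (cancel x) (<-respʳ-≈ (cancel y) (*-monoʳ-< (0<recip 0<z) zx<zy))
    where
    cancel : ∀ x → recip z 0<z * (z * x) ≈ x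
    cancel x = trans (sym (*-assoc _ z x)) (trans (*-congʳ (recip-inverseˡ 0<z)) (*-identityˡ x))

  *-monoʳ-≤ : ∀ {z x y} → 0# < z → x ≤ y → z * x ≤ z * y
  *-monoʳ-≤ 0<z x≤y zy<zx = x≤y (*-cancelˡ-< 0<z zy<zx)

  fromℕ-+ : ∀ m n → fromℕ (m ℕ.+ n) ≈ fromℕ m + fromℕ n
  fromℕ-+ = ×-homo-+ 1#

  fromℕ-* : ∀ m n → fromℕ (m ℕ.* n) ≈ fromℕ m * fromℕ n
  fromℕ-* = ×1-homo-*

  0<fromℕ : ∀ {n} → 0 ℕ.< n → 0# < fromℕ n
  0<fromℕ {suc n} _ = 0<fromℕ-suc n

  *-fromℕ-mono-≤ : ∀ {x m n} → 0# ≤ x → m ℕ.≤ n → x * fromℕ m ≤ x * fromℕ n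
  *-fromℕ-mono-≤ {x} {m} {n} 0≤x m≤n =
    ≤-respˡ-≈ (+-identityʳ _) (≤-respʳ-≈ eq
      (+-mono-≤ (≤-reflexive (refl {x * fromℕ m})) (nonneg (n ℕ.∸ m))))
    where
    nonneg : ∀ d → 0# ≤ x * fromℕ d
    nonneg zero    = ≤-reflexive (sym (zeroʳ x))
    nonneg (suc d) = ≤-respˡ-≈ (+-identityʳ 0#)
      (≤-respʳ-≈ (sym (trans (distribˡ x 1# (fromℕ d)) (+-congʳ (*-identityʳ x))))
        (+-mono-≤ 0≤x (nonneg d)))
    eq : x * fromℕ m + x * fromℕ (n ℕ.∸ m) ≈ x * fromℕ n
    eq = trans (sym (distribˡ x _ _))
      (*-congˡ (trans (sym (fromℕ-+ m (n ℕ.∸ m))) (×-congˡ (ℕ.m+[n∸m]≡n m≤n))))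

  fromℕ-mono-≤ : ∀ {m n} → m ℕ.≤ n → fromℕ m ≤ fromℕ n
  fromℕ-mono-≤ m≤n = ≤-respˡ-≈ (*-identityˡ _)
    (≤-respʳ-≈ (*-identityˡ _) (*-fromℕ-mono-≤ (<⇒≤ 0<1) m≤n))

  sum-mono-≤ : ∀ {n} (f g : Fin n → Carrier) → (∀ i → f i ≤ g i) → sum f ≤ sum g
  sum-mono-≤ {zero}  f g f≤g = ≤-reflexive refl
  sum-mono-≤ {suc n} f g f≤g = +-mono-≤ (f≤g zero) (sum-mono-≤ (f ∘ suc) (g ∘ suc) (f≤g ∘ suc))

  -- Expectations over random subsets.

  listSum : ∀ {a} {A : Set a} → (A → Carrier) → List A → Carrier
  listSum f xs = List.foldr _+_ 0# (List.map f xs)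

  listSum-++ : ∀ {a} {A : Set a} (f : A → Carrier) xs ys →
    listSum f (xs List.++ ys) ≈ listSum f xs + listSum f ys
  listSum-++ f []       ys = sym (+-identityˡ _)
  listSum-++ f (x ∷ xs) ys = trans (+-congˡ (listSum-++ f xs ys)) (sym (+-assoc _ _ _))

  listSum-map : ∀ {a b} {A : Set a} {B : Set b} (f : B → Carrier) (g : A → B) xs →
    listSum f (List.map g xs) ≈ listSum (f ∘ g) xs
  listSum-map f g xs = reflexive (≡.cong (List.foldr _+_ 0#) (≡.sym (List.map-∘ xs)))

  listSum-*-cong : ∀ {a} {A : Set a} k {f g : A → Carrier} → (∀ x → f x ≈ k * g x) →
    ∀ xs → listSum f xs ≈ k * listSum g xs
  listSum-*-cong k f≈kg []       = sym (zeroʳ k)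
  listSum-*-cong k f≈kg (x ∷ xs) =
    trans (+-cong (f≈kg x) (listSum-*-cong k f≈kg xs)) (sym (distribˡ k _ _))

  -- Model.prob and Model.𝔼 unfold to these when p is the edge probability of a stochastic graph.
  probability : ∀ {n} → (Fin n → Carrier) → Subset n → Carrier
  probability p S = product (λ e → if lookup S e then p e else (1# - p e))

  expectation : ∀ {n} → (Fin n → Carrier) → (Subset n → Carrier) → Carrier
  expectation {n} p X = listSum (λ S → probability p S * X S) (subsets n)

  -- Conditioning on the first edge: `subsets` splits by its membership, and its factor comes out of
  -- the product in each half.
  expectation-suc : ∀ {n} (p : Fin (suc n) → Carrier) X → expectation p X ≈
    p zero * expectation (p ∘ suc) (X ∘ (inside ∷_)) +
    (1# - p zero) * expectation (p ∘ suc) (X ∘ (outside ∷_))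
  expectation-suc {n} p X = trans (listSum-++ _ (List.map (inside ∷_) (subsets n)) _)
    (+-cong (part inside) (part outside))
    where
    part : ∀ b → listSum (λ S → probability p S * X S) (List.map (b ∷_) (subsets n)) ≈
      (if b then p zero else (1# - p zero)) * expectation (p ∘ suc) (X ∘ (b ∷_))
    part b = trans (listSum-map _ (b ∷_) (subsets n))
      (listSum-*-cong _ (λ S → *-assoc _ _ _) (subsets n))

  ½ : Carrier
  ½ = recip (fromℕ 2) (0<fromℕ-suc 1)

  0<½ : 0# < ½
  0<½ = 0<recip (0<fromℕ-suc 1)

  ½+½≈1 : ½ + ½ ≈ 1#
  ½+½≈1 = trans (sym (+-cong (*-identityʳ ½) (trans (*-congˡ (+-identityʳ 1#)) (*-identityʳ ½))))
    (trans (sym (distribˡ ½ 1# _)) (recip-inverseˡ (0<fromℕ-suc 1)))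

  1-½≈½ : 1# - ½ ≈ ½
  1-½≈½ = trans (+-congʳ (sym ½+½≈1)) (Group.//-rightDividesʳ +-group ½ ½)

  ½<1 : ½ < 1#
  ½<1 = <-respˡ-≈ (+-identityʳ ½) (<-respʳ-≈ ½+½≈1 (+-monoʳ-< ½ 0<½))

  0<½^ : ∀ m → 0# < ½ ^ m
  0<½^ zero    = 0<1
  0<½^ (suc m) = *-pos 0<½ (0<½^ m)

  expectation-uniform : ∀ m (X : Subset m → ℕ) →
    expectation (λ _ → ½) (fromℕ ∘ X) ≈ ½ ^ m * fromℕ (total m X)
  expectation-uniform zero    X = +-identityʳ _
  expectation-uniform (suc m) X = begin
    expectation (λ _ → ½) (fromℕ ∘ X)
      ≈⟨ expectation-suc (λ _ → ½) (fromℕ ∘ X) ⟩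
    ½ * expectation (λ _ → ½) (fromℕ ∘ X ∘ (inside ∷_)) +
    (1# - ½) * expectation (λ _ → ½) (fromℕ ∘ X ∘ (outside ∷_))
      ≈⟨ +-cong (*-congˡ (expectation-uniform m (X ∘ (inside ∷_))))
           (*-cong 1-½≈½ (expectation-uniform m (X ∘ (outside ∷_)))) ⟩
    ½ * (½ ^ m * fromℕ (total m (X ∘ (inside ∷_)))) + ½ * (½ ^ m * fromℕ (total m (X ∘ (outside ∷_))))
      ≈⟨ +-cong (*-assoc _ _ _) (*-assoc _ _ _) ⟨
    ½ ^ suc m * fromℕ (total m (X ∘ (inside ∷_))) + ½ ^ suc m * fromℕ (total m (X ∘ (outside ∷_)))
      ≈⟨ distribˡ _ _ _ ⟨
    ½ ^ suc m * (fromℕ (total m (X ∘ (inside ∷_))) + fromℕ (total m (X ∘ (outside ∷_))))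
      ≈⟨ *-congˡ (fromℕ-+ (total m (X ∘ (inside ∷_))) _) ⟨
    ½ ^ suc m * fromℕ (total (suc m) X) ∎
    where open ≈-Reasoning setoid

  -- Recursion on `k` makes the tail of the family again such a family, so an induction can peel off
  -- one certain edge at a time.
  certainThenFair : ∀ k {m} → Fin (k ℕ.+ m) → Carrier
  certainThenFair zero    _       = ½
  certainThenFair (suc k) zero    = 1#
  certainThenFair (suc k) (suc e) = certainThenFair k e

  -- For a certain edge the branch in which it is absent has coefficient 1 - 1 and vanishes.
  expectation-certainThenFair : ∀ k {m} (X : Subset (k ℕ.+ m) → Carrier) →
    expectation (certainThenFair k) X ≈ expectation (λ _ → ½) (λ T → X (replicate k inside ++ T))
  expectation-certainThenFair zero    X = refl
  expectation-certainThenFair (suc k) X = begin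
    expectation (certainThenFair (suc k)) X
      ≈⟨ expectation-suc (certainThenFair (suc k)) X ⟩
    1# * expectation (certainThenFair k) (X ∘ (inside ∷_)) +
    (1# - 1#) * expectation (certainThenFair k) (X ∘ (outside ∷_))
      ≈⟨ +-cong (*-identityˡ _) (trans (*-congʳ (-‿inverseʳ 1#)) (zeroˡ _)) ⟩
    expectation (certainThenFair k) (X ∘ (inside ∷_)) + 0#
      ≈⟨ +-identityʳ _ ⟩
    expectation (certainThenFair k) (X ∘ (inside ∷_))
      ≈⟨ expectation-certainThenFair k (X ∘ (inside ∷_)) ⟩
    expectation (λ _ → ½) (λ T → X (inside ∷ replicate k inside ++ T)) ∎
    where open ≈-Reasoning setoid

  0≤certainThenFair : ∀ k {m} (e : Fin (k ℕ.+ m)) → 0# ≤ certainThenFair k e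
  0≤certainThenFair zero    _       = <⇒≤ 0<½
  0≤certainThenFair (suc k) zero    = <⇒≤ 0<1
  0≤certainThenFair (suc k) (suc e) = 0≤certainThenFair k e

  certainThenFair≤1 : ∀ k {m} (e : Fin (k ℕ.+ m)) → certainThenFair k e ≤ 1#
  certainThenFair≤1 zero    _       = <⇒≤ ½<1
  certainThenFair≤1 (suc k) zero    = ≤-reflexive refl
  certainThenFair≤1 (suc k) (suc e) = certainThenFair≤1 k e

  -- The hard instance and the comparison with γ · OPT.

  coronaInstance : ℕ → StochasticGraph
  coronaInstance n = record
    { graph = coronaGraph n
    ; p     = certainThenFair (n ℕ.* n)
    ; 0≤p   = 0≤certainThenFair (n ℕ.* n)
    ; p≤1   = certainThenFair≤1 (n ℕ.* n)
    }

  module _ (n : ℕ) where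

    𝔼-corona : ∀ (X : Subset (n ℕ.* n ℕ.+ (n ℕ.+ n)) → ℕ) → 𝔼 (coronaInstance n) (fromℕ ∘ X) ≈
      ½ ^ (n ℕ.+ n) * fromℕ (total (n ℕ.+ n) (X ∘ realization {n}))
    𝔼-corona X = trans (expectation-certainThenFair (n ℕ.* n) (fromℕ ∘ X))
      (expectation-uniform (n ℕ.+ n) (X ∘ realization {n}))

    -- The bound holds for every seed, hence for their average, since the weights are nonnegative
    -- and sum to 1.
    expectedSize≤ : (A : RandomizedPolicy (coronaInstance n)) →
      expectedSize (coronaInstance n) A (coreFirst {n}) ≤ ½ ^ (n ℕ.+ n) * fromℕ (n ℕ.* 2 ℕ.^ (n ℕ.+ n))
    expectedSize≤ A = ≤-respʳ-≈ Σweight*bound (sum-mono-≤ _ _ pointwise)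
      where
      open RandomizedPolicy A
      r bound : Carrier
      r     = ½ ^ (n ℕ.+ n)
      bound = r * fromℕ (n ℕ.* 2 ℕ.^ (n ℕ.+ n))
      Σweight*bound : sum (λ ω → weight ω * bound) ≈ bound
      Σweight*bound = trans (sym (*-distribʳ-sum bound weight))
        (trans (*-congʳ Σweight) (*-identityˡ bound))
      0≤r*weight : ∀ ω → 0# ≤ r * weight ω
      0≤r*weight ω = ≤-respˡ-≈ (zeroʳ r) (*-monoʳ-≤ (0<½^ (n ℕ.+ n)) (0≤weight ω))
      size : Fin #seeds → Subset (n ℕ.* n ℕ.+ (n ℕ.+ n)) → ℕ
      size ω S = ∣ outcome (coronaGraph n) (policy ω) (coreFirst {n}) S ∣
      pointwise : ∀ ω → weight ω * 𝔼 (coronaInstance n) (fromℕ ∘ size ω) ≤ weight ω * bound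
      -- Moving the weight next to `r` leaves a nonnegative factor times a natural number, to which
      -- `total-∣result∣≤` applies.
      pointwise ω = ≤-respˡ-≈ (sym (trans (*-congˡ (𝔼-corona (size ω))) (regroup _)))
        (≤-respʳ-≈ (sym (regroup _)) (*-fromℕ-mono-≤ (0≤r*weight ω) (total-∣result∣≤ {n} (policy ω))))
        where
        regroup : ∀ x → weight ω * (r * x) ≈ r * weight ω * x
        regroup x = trans (x∙yz≈y∙xz (weight ω) r x) (sym (*-assoc r (weight ω) x))

    OPT-corona : OPT (coronaInstance n) ≈ ½ ^ (n ℕ.+ n) * fromℕ (totalOPT {n})
    OPT-corona = 𝔼-corona (maxMatchingSize (coronaGraph n))

    expectedSize<γOPT : ∀ {γ} (A : RandomizedPolicy (coronaInstance n)) →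
      fromℕ (n ℕ.* 2 ℕ.^ (n ℕ.+ n)) < γ * fromℕ (totalOPT {n}) →
      expectedSize (coronaInstance n) A (coreFirst {n}) < γ * OPT (coronaInstance n)
    expectedSize<γOPT {γ} A nN<γOPT = ≤-<-trans (expectedSize≤ A)
      (<-respʳ-≈ (trans (x∙yz≈y∙xz _ γ _) (*-congˡ (sym OPT-corona)))
        (*-monoʳ-< (0<½^ (n ℕ.+ n)) nN<γOPT))

  3*2/3≈2 : fromℕ 3 * 2/3 ≈ fromℕ 2
  3*2/3≈2 = trans (x∙yz≈y∙xz (fromℕ 3) (fromℕ 2) _)
    (trans (*-congˡ (recip-inverseʳ (0<fromℕ-suc 2))) (*-identityʳ (fromℕ 2)))

  archimedean-recip : ∀ {ε} → 0# < ε → ∃ λ t → ℕ.NonZero t × 1# < ε * fromℕ t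
  archimedean-recip {ε} 0<ε with archimedean (recip ε 0<ε)
  -- The successor guarantees that the witness is nonzero.
  ... | t , 1/ε<t = suc t , _ , <-respˡ-≈ (recip-inverseʳ 0<ε)
    (*-monoʳ-< 0<ε (<-≤-trans 1/ε<t (fromℕ-mono-≤ (ℕ.n≤1+n t))))

  0<3γ-2 : ∀ {γ} → 2/3 < γ → 0# < fromℕ 3 * γ - fromℕ 2
  0<3γ-2 2/3<γ = x<y⇒0<y-x (<-respˡ-≈ 3*2/3≈2 (*-monoʳ-< (0<fromℕ-suc 2) 2/3<γ))

  -- If ε = 3γ − 2 and ε t > 1, then 3K ≤ 2P + N < 2P + ε t N ≤ 3γP.
  3K≤2P+N⇒K<γP : ∀ {γ} t K N P (2/3<γ : 2/3 < γ) → 1# < (fromℕ 3 * γ - fromℕ 2) * fromℕ t →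
    0 ℕ.< N → 3 ℕ.* K ℕ.≤ 2 ℕ.* P ℕ.+ N → t ℕ.* N ℕ.≤ P → fromℕ K < γ * fromℕ P
  3K≤2P+N⇒K<γP {γ} t K N P 2/3<γ 1<εt 0<N 3K≤2P+N tN≤P = *-cancelˡ-< (0<fromℕ-suc 2)
    (<-respʳ-≈ 2P+εP≈3γP (≤-<-trans 3K≤ (+-monoʳ-< (fromℕ 2 * fromℕ P) N<εP)))
    where
    open ≈-Reasoning setoid
    ε : Carrier
    ε = fromℕ 3 * γ - fromℕ 2
    3K≤ : fromℕ 3 * fromℕ K ≤ fromℕ 2 * fromℕ P + fromℕ N
    3K≤ = ≤-respˡ-≈ (fromℕ-* 3 K)
      (≤-respʳ-≈ (trans (fromℕ-+ (2 ℕ.* P) N) (+-congʳ (fromℕ-* 2 P))) (fromℕ-mono-≤ 3K≤2P+N))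
    N<εP : fromℕ N < ε * fromℕ P
    N<εP = <-≤-trans
      (<-respˡ-≈ (*-identityˡ (fromℕ N))
        (<-respʳ-≈ (trans (*-assoc ε _ _) (*-congˡ (sym (fromℕ-* t N)))) (*-monoˡ-< (0<fromℕ 0<N) 1<εt)))
      (*-monoʳ-≤ (0<3γ-2 2/3<γ) (fromℕ-mono-≤ tN≤P))
    2P+εP≈3γP : fromℕ 2 * fromℕ P + ε * fromℕ P ≈ fromℕ 3 * (γ * fromℕ P)
    2P+εP≈3γP = begin
      fromℕ 2 * fromℕ P + ε * fromℕ P ≈⟨ distribʳ (fromℕ P) (fromℕ 2) ε ⟨
      (fromℕ 2 + ε) * fromℕ P         ≈⟨ *-congʳ (+-comm (fromℕ 2) ε) ⟩
      (ε + fromℕ 2) * fromℕ P         ≈⟨ *-congʳ (Group.//-rightDividesˡ +-group (fromℕ 2) (fromℕ 3 * γ)) ⟩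
      fromℕ 3 * γ * fromℕ P           ≈⟨ *-assoc (fromℕ 3) γ (fromℕ P) ⟩
      fromℕ 3 * (γ * fromℕ P)         ∎

  module _ {γ t n} (2/3<γ : 2/3 < γ) (1<εt : 1# < (fromℕ 3 * γ - fromℕ 2) * fromℕ t)
           (bounds : OPTBounds t n) where
    open OPTBounds bounds

    corona-hard : (A : RandomizedPolicy (coronaInstance n)) →
      expectedSize (coronaInstance n) A (coreFirst {n}) < γ * OPT (coronaInstance n)
    corona-hard A = expectedSize<γOPT n A
      -- Here the `N` of the arithmetic lemma is the shortfall `t * 2 ^ (n + n)`, not the number of
      -- realizations.
      (3K≤2P+N⇒K<γP t (n ℕ.* 2 ℕ.^ (n ℕ.+ n)) (t ℕ.* 2 ℕ.^ (n ℕ.+ n)) (totalOPT {n})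
        2/3<γ 1<εt 0<tN 3nN≤2OPT+tN t*tN≤OPT)

theorem6p1 : ∀ {c ℓ₁ ℓ₂ ℓ₃} (F : ArchimedeanOrderedField c ℓ₁ ℓ₂ ℓ₃) →
    let open ArchimedeanOrderedField F
        open Model F in
    (γ : Carrier) → 2/3 < γ →
    (A : OnlineAlgorithm) →
    Σ StochasticGraph λ I →
    Σ (ArrivalOrder (StochasticGraph.graph I)) λ σ →
      expectedSize I (A I) σ < γ * OPT I
theorem6p1 F γ 2/3<γ A = hardInstance (archimedean-recip F (0<3γ-2 F 2/3<γ))
  where
  open ArchimedeanOrderedField F
  open Model F
  hardInstance : (∃ λ t → ℕ.NonZero t × 1# < (fromℕ 3 * γ - fromℕ 2) * fromℕ t) →
    Σ StochasticGraph λ I → Σ (ArrivalOrder (StochasticGraph.graph I)) λ σ →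
      expectedSize I (A I) σ < γ * OPT I
  -- The instance and the order depend on `γ` but not on `A`, which is consulted only for its policy
  -- on this instance; one instance thus defeats all algorithms for the given `γ`.
  hardInstance (t , t≢0 , 1<εt) = coronaInstance F n , coreFirst {n} ,
    corona-hard F {t = t} {n} 2/3<γ 1<εt (optBounds t {{t≢0}}) (A (coronaInstance F n))
    where
    n : ℕ
    n = 2 ℕ.* (t ℕ.* t)
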